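{- Every typable term of $\lambda_{\mathrm{MELL}}$ is strongly normalizing: if $\Delta;\Gamma\vdash t:A$ is derivable, then there is no infinite pre-reduction sequence $t\to^-t_1\to^-t_2\to^-\cdots$.
   Context: MELL formulae: $A,B::=\alpha\mid\overline\alpha\mid A\otimes B\mid A\wp B\mid\mathbf 1\mid\bot\mid{!}A\mid{?}A$ ($\alpha$ atomic, $\overline\alpha$ its negative version, $\wp$ is "par"). Linear negation is the involution $\alpha^\perp=\overline\alpha$, $\overline\alpha^\perp=\alpha$, $(A\otimes B)^\perp=A^\perp\wp B^\perp$, $(A\wp B)^\perp=A^\perp\otimes B^\perp$, $\mathbf1^\perp=\bot$, $\bot^\perp=\mathbf1$, $({!}A)^\perp={?}(A^\perp)$, $({?}A)^\perp={!}(A^\perp)$. Terms of $\lambda_{\mathrm{MELL}}$, over linear variables $a,b,c,\dots$ and unrestricted variables $u,v,\dots$: $t,s::=a\mid u\mid\langle t,s\rangle\mid t[\langle a,b\rangle:=s]\mid\wp(a,b).t\mid t\bullet s\mid t\blacktriangledown s\mid{!}a.t\mid t[{!}u:=s]\mid{?}u.t\mid t\blacktriangleright^{a}s\mid t\,\sharp\,s\mid\star\mid t[\star:=s]$. Binding: $t[\langle a,b\rangle:=s]$ and $\wp(a,b).t$ bind $a,b$ in $t$; ${!}a.t$ and $t\blacktriangleright^a s$ bind $a$ in $t$; $t[{!}u:=s]$ and ${?}u.t$ bind $u$ in $t$. Terms are taken up to $\alpha$-renaming, and bound variables are always chosen to avoid capture. Typing judgements $\Delta;\Gamma\vdash t:A$,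 where $\Delta$ (resp. $\Gamma$) is a finite partial function from unrestricted (resp. linear) variables to formulae; $\Gamma,\Gamma'$ denotes union with disjoint domains. Typing rules (premises $\Rightarrow$ conclusion): $\Rightarrow\Delta;a:A\vdash a:A$; $\Rightarrow\Delta,u:A;\cdot\vdash u:A$; $\Delta;\Gamma\vdash t:A$ and $\Delta;\Gamma'\vdash s:B$ $\Rightarrow$ $\Delta;\Gamma,\Gamma'\vdash\langle t,s\rangle:A\otimes B$; $\Delta;\Gamma\vdash s:A\otimes B$ and $\Delta;\Gamma',a:A,b:B\vdash t:C$ $\Rightarrow$ $\Delta;\Gamma,\Gamma'\vdash t[\langle a,b\rangle:=s]:C$; $\Delta;\Gamma,a:A,b:B\vdash t:\bot$ $\Rightarrow$ $\Delta;\Gamma\vdash\wp(a,b).t:A^\perp\wp B^\perp$; $\Delta;\Gamma\vdash t:A\wp B$ and $\Delta;\Gamma'\vdash s:A^\perp$ $\Rightarrow$ $\Delta;\Gamma,\Gamma'\vdash t\bullet s:B$; $\Delta;\Gamma\vdash t:A\wp B$ and $\Delta;\Gamma'\vdash s:B^\perp$ $\Rightarrow$ $\Delta;\Gamma,\Gamma'\vdash t\blacktriangledown s:A$; $\Delta;a:A\vdash t:\bot$ $\Rightarrow$ $\Delta;\cdot\vdash{!}a.t:{!}(A^\perp)$; $\Delta;\Gamma\vdash s:{!}A$ and $\Delta,u:A;\Gamma'\vdash t:B$ $\Rightarrow$ $\Delta;\Gamma,\Gamma'\vdash t[{!}u:=s]:B$; $\Delta,u:A^\perp;\Gamma\vdash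 t:\bot$ $\Rightarrow$ $\Delta;\Gamma\vdash{?}u.t:{?}A$; $\Delta;\Gamma\vdash s:{?}A$ and $\Delta;a:A\vdash t:\bot$ $\Rightarrow$ $\Delta;\Gamma\vdash t\blacktriangleright^a s:\bot$; $\Delta;\Gamma\vdash t:B$ and $\Delta;\Gamma'\vdash s:B^\perp$ $\Rightarrow$ $\Delta;\Gamma,\Gamma'\vdash t\,\sharp\,s:\bot$; $\Rightarrow\Delta;\cdot\vdash\star:\mathbf1$; $\Delta;\Gamma\vdash s:\mathbf1$ and $\Delta;\Gamma'\vdash t:A$ $\Rightarrow$ $\Delta;\Gamma,\Gamma'\vdash t[\star:=s]:A$. A term is linear if: each free linear variable occurs exactly once; each bound linear variable occurs exactly once in the scope of its binder; subterms ${!}a.t$ have no free linear variables; in subterms $t\blacktriangleright^a s$ only $a$ occurs as a free linear variable in $t$. $t\{a:=s\}$, $t\{u:=s\}$ denote capture-avoiding substitution. For a linear term $t$ with $a\in\mathrm{fv}(t)$, the contra-substitution $t\{a\backslash\!\backslash s\}$ is defined by induction on $t$ (case "$i$" applies when $a\in\mathrm{fv}(t_i)$): $a\{a\backslash\!\backslash s\}=s$; $\langle t_1,t_2\rangle\{a\backslash\!\backslash s\}=t_1\{a\backslash\!\backslash s\blacktriangledown t_2\}$ (case 1), $t_2\{a\backslash\!\backslash s\bullet t_1\}$ (case 2); $(t_1\bullet t_2)\{a\backslash\!\backslash s\}=t_1\{a\backslash\!\backslash\langle t_2,s\rangle\}$ (1), $t_2\{a\backslash\!\backslash t_1\blacktriangledown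 s\}$ (2); $(t_1\blacktriangledown t_2)\{a\backslash\!\backslash s\}=t_1\{a\backslash\!\backslash\langle s,t_2\rangle\}$ (1), $t_2\{a\backslash\!\backslash t_1\bullet s\}$ (2); $(t_1[\langle b,c\rangle:=t_2])\{a\backslash\!\backslash s\}=(t_1\{a\backslash\!\backslash s\})[\langle b,c\rangle:=t_2]$ (1, $a\notin\{b,c\}$), $t_2\{a\backslash\!\backslash\wp(b,c).(t_1\sharp s)\}$ (2); $(\wp(b,c).t)\{a\backslash\!\backslash s\}=(t\{a\backslash\!\backslash\star\})[\langle b,c\rangle:=s]$; $(t_1[{!}u:=t_2])\{a\backslash\!\backslash s\}=(t_1\{a\backslash\!\backslash s\})[{!}u:=t_2]$ (1), $t_2\{a\backslash\!\backslash{?}u.(t_1\sharp s)\}$ (2); $({?}u.t)\{a\backslash\!\backslash s\}=(t\{a\backslash\!\backslash\star\})[{!}u:=s]$; $(t_1\blacktriangleright^b t_2)\{a\backslash\!\backslash s\}=(t_2\{a\backslash\!\backslash{!}b.t_1\})[\star:=s]$ (only case 2 is possible); $(t_1\sharp t_2)\{a\backslash\!\backslash s\}=(t_1\{a\backslash\!\backslash t_2\})[\star:=s]$ (1), $(t_2\{a\backslash\!\backslash t_1\})[\star:=s]$ (2); $(t_1[\star:=t_2])\{a\backslash\!\backslash s\}=(t_1\{a\backslash\!\backslash s\})[\star:=t_2]$ (1), $t_2\{a\backslash\!\backslash t_1\sharp s\}$ (2). (Terms ${!}b.t$ and $\star$ have no free linear variables, so no clause is needed.) Positive elimination contexts: $L,K::=\Box\mid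 L[\langle a,b\rangle:=t]\mid L[{!}u:=t]\mid L[\star:=t]$; $tL$ denotes filling the hole of $L$ with $t$ (free variables of $t$ may be captured by $L$). Pre-reduction $\to^-$ is the contextual closure (under all term constructors) of the following axioms, where both sides are assumed typed with the same type in the same contexts: $(\wp(a,b).t)L\bullet r\mapsto t\{a:=r\}\{b\backslash\!\backslash\star\}L$ ($b\notin\mathrm{fv}(r)$); $(\wp(a,b).t)L\blacktriangledown r\mapsto t\{b:=r\}\{a\backslash\!\backslash\star\}L$ ($a\notin\mathrm{fv}(r)$); $t[\langle a,b\rangle:=\langle s,r\rangle L]\mapsto t\{a:=s\}\{b:=r\}L$ ($b\notin\mathrm{fv}(s)$); $t[{!}u:=({!}a.s)L]\mapsto t\{u:=s\{a\backslash\!\backslash\star\}\}L$; $t\blacktriangleright^a({?}u.s)L\mapsto s\{u:=t\{a\backslash\!\backslash\star\}\}L$; $(\wp(a,b).t)L\,\sharp\,\langle s,r\rangle K\mapsto t\{a:=s\}\{b:=r\}LK$ ($b\notin\mathrm{fv}(s)$); $\langle s,r\rangle L\,\sharp\,(\wp(a,b).t)K\mapsto t\{a:=s\}\{b:=r\}LK$ ($b\notin\mathrm{fv}(s)$); $({!}a.t)L\,\sharp\,({?}u.r)K\mapsto r\{u:=t\{a\backslash\!\backslash\star\}\}LK$; $({?}u.r)L\,\sharp\,({!}a.t)K\mapsto r\{u:=t\{a\backslash\!\backslash\star\}\}LK$. -}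

module Defs where

open import Data.Bool.Base using (Bool; true; false; _∨_; if_then_else_)
open import Data.Fin.Base using (Fin; zero; suc; lift)
open import Data.Fin.Properties using (_≟_)
open import Data.Maybe.Base using (Maybe; just; nothing)
open import Data.Nat.Base using (ℕ; zero; suc; _+_)
open import Data.Vec.Base using (Vec; []; _∷_; lookup; replicate; _[_]≔_)
open import Data.Vec.Functional using (insertAt)
open import Function.Base using (id; _∘_)
open import Relation.Nullary.Decidable.Core using (does)

infix  9 _^⊥
infixr 8 !_ ⁇_
infixr 7 _⊗_ _⅋_

-- ⁇_ is the exponential "?" (a bare ? is reserved in Agda).
data Formula : Set where
  atom  : ℕ → Formula
  atom⁻ : ℕ → Formula
  _⊗_   : Formula → Formula → Formula
  _⅋_   : Formula → Formula → Formula
  𝟏     : Formula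
  ⊥     : Formula
  !_    : Formula → Formula
  ⁇_    : Formula → Formula

_^⊥ : Formula → Formula
atom α  ^⊥ = atom⁻ α
atom⁻ α ^⊥ = atom α
(A ⊗ B) ^⊥ = A ^⊥ ⅋ B ^⊥
(A ⅋ B) ^⊥ = A ^⊥ ⊗ B ^⊥
𝟏 ^⊥       = ⊥
⊥ ^⊥       = 𝟏
(! A) ^⊥   = ⁇ (A ^⊥)
(⁇ A) ^⊥   = ! (A ^⊥)

-- Terms up to α-renaming are well-scoped de Bruijn terms: Tm m n has m
-- unrestricted and n linear variables in scope, in separate index spaces.
-- A binder of two linear variables a, b makes b index 0 and a index 1.
-- The body t is always the first argument of t [⟨⟩≔ s ], t [!≔ s ],
-- t ▶ s and t [⋆≔ s ].  As in the grammar, linearity is not part of the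
-- syntax; it is enforced by typing.

infix  10 _[⟨⟩≔_] _[!≔_] _[⋆≔_]
infixl 9  _•_ _▾_
infix  8  _♯_ _▶_
infixr 7  ⅋λ_ !λ_ ?λ_

data Tm (m n : ℕ) : Set where
  lvar    : Fin n → Tm m n
  uvar    : Fin m → Tm m n
  ⟨_,_⟩   : Tm m n → Tm m n → Tm m n
  _[⟨⟩≔_] : Tm m (2 + n) → Tm m n → Tm m n
  ⅋λ_     : Tm m (2 + n) → Tm m n
  _•_     : Tm m n → Tm m n → Tm m n
  _▾_     : Tm m n → Tm m n → Tm m n
  !λ_     : Tm m (1 + n) → Tm m n
  _[!≔_]  : Tm (1 + m) n → Tm m n → Tm m n
  ?λ_     : Tm (1 + m) n → Tm m n
  _▶_     : Tm m (1 + n) → Tm m n → Tm m n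
  _♯_     : Tm m n → Tm m n → Tm m n
  ⋆       : Tm m n
  _[⋆≔_]  : Tm m n → Tm m n → Tm m n

UCtx : ℕ → Set
UCtx m = Vec Formula m

-- Finite partial functions from the linear variables in scope to formulae.
LCtx : ℕ → Set
LCtx n = Vec (Maybe Formula) n

∅ : ∀ {n} → LCtx n
∅ = replicate _ nothing

[_↦_] : ∀ {n} → Fin n → Formula → LCtx n
[ a ↦ A ] = ∅ [ a ]≔ just A

-- Γ₁ , Γ₂ ≣ Γ: the domains of Γ₁ and Γ₂ are disjoint and Γ is their union.
infix 4 _,_≣_

data _,_≣_ : ∀ {n} → LCtx n → LCtx n → LCtx n → Set where
  []      : [] , [] ≣ []
  neither : ∀ {n} {Γ₁ Γ₂ Γ : LCtx n} → Γ₁ , Γ₂ ≣ Γ →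
            nothing ∷ Γ₁ , nothing ∷ Γ₂ ≣ nothing ∷ Γ
  left    : ∀ {n} {Γ₁ Γ₂ Γ : LCtx n} {A} → Γ₁ , Γ₂ ≣ Γ →
            just A ∷ Γ₁ , nothing ∷ Γ₂ ≣ just A ∷ Γ
  right   : ∀ {n} {Γ₁ Γ₂ Γ : LCtx n} {A} → Γ₁ , Γ₂ ≣ Γ →
            nothing ∷ Γ₁ , just A ∷ Γ₂ ≣ just A ∷ Γ

infix 3 _﹔_⊢_∶_

data _﹔_⊢_∶_ {m n : ℕ} (Δ : UCtx m) : LCtx n → Tm m n → Formula → Set where

  lax : ∀ {a A} →
        Δ ﹔ [ a ↦ A ] ⊢ lvar a ∶ A

  uax : ∀ {u} →
        Δ ﹔ ∅ ⊢ uvar u ∶ lookup Δ u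

  ⊗I  : ∀ {Γ Γ₁ Γ₂ t s A B} → Γ₁ , Γ₂ ≣ Γ →
        Δ ﹔ Γ₁ ⊢ t ∶ A →
        Δ ﹔ Γ₂ ⊢ s ∶ B →
        Δ ﹔ Γ ⊢ ⟨ t , s ⟩ ∶ A ⊗ B

  ⊗E  : ∀ {Γ Γ₁ Γ₂ t s A B C} → Γ₁ , Γ₂ ≣ Γ →
        Δ ﹔ Γ₁ ⊢ s ∶ A ⊗ B →
        Δ ﹔ just B ∷ just A ∷ Γ₂ ⊢ t ∶ C →
        Δ ﹔ Γ ⊢ t [⟨⟩≔ s ] ∶ C

  ⅋I  : ∀ {Γ t A B} →
        Δ ﹔ just B ∷ just A ∷ Γ ⊢ t ∶ ⊥ →
        Δ ﹔ Γ ⊢ ⅋λ t ∶ A ^⊥ ⅋ B ^⊥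

  ⅋E₁ : ∀ {Γ Γ₁ Γ₂ t s A B} → Γ₁ , Γ₂ ≣ Γ →
        Δ ﹔ Γ₁ ⊢ t ∶ A ⅋ B →
        Δ ﹔ Γ₂ ⊢ s ∶ A ^⊥ →
        Δ ﹔ Γ ⊢ t • s ∶ B

  ⅋E₂ : ∀ {Γ Γ₁ Γ₂ t s A B} → Γ₁ , Γ₂ ≣ Γ →
        Δ ﹔ Γ₁ ⊢ t ∶ A ⅋ B →
        Δ ﹔ Γ₂ ⊢ s ∶ B ^⊥ →
        Δ ﹔ Γ ⊢ t ▾ s ∶ A

  !I  : ∀ {t A} →
        Δ ﹔ just A ∷ ∅ ⊢ t ∶ ⊥ →
        Δ ﹔ ∅ ⊢ !λ t ∶ ! (A ^⊥)

  !E  : ∀ {Γ Γ₁ Γ₂ t s A B} → Γ₁ , Γ₂ ≣ Γ →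
        Δ ﹔ Γ₁ ⊢ s ∶ ! A →
        A ∷ Δ ﹔ Γ₂ ⊢ t ∶ B →
        Δ ﹔ Γ ⊢ t [!≔ s ] ∶ B

  ?I  : ∀ {Γ t A} →
        A ^⊥ ∷ Δ ﹔ Γ ⊢ t ∶ ⊥ →
        Δ ﹔ Γ ⊢ ?λ t ∶ ⁇ A

  ?E  : ∀ {Γ t s A} →
        Δ ﹔ Γ ⊢ s ∶ ⁇ A →
        Δ ﹔ just A ∷ ∅ ⊢ t ∶ ⊥ →
        Δ ﹔ Γ ⊢ t ▶ s ∶ ⊥

  cut : ∀ {Γ Γ₁ Γ₂ t s B} → Γ₁ , Γ₂ ≣ Γ →
        Δ ﹔ Γ₁ ⊢ t ∶ B →
        Δ ﹔ Γ₂ ⊢ s ∶ B ^⊥ →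
        Δ ﹔ Γ ⊢ t ♯ s ∶ ⊥

  𝟏I  : Δ ﹔ ∅ ⊢ ⋆ ∶ 𝟏

  𝟏E  : ∀ {Γ Γ₁ Γ₂ t s A} → Γ₁ , Γ₂ ≣ Γ →
        Δ ﹔ Γ₁ ⊢ s ∶ 𝟏 →
        Δ ﹔ Γ₂ ⊢ t ∶ A →
        Δ ﹔ Γ ⊢ t [⋆≔ s ] ∶ A

ren : ∀ {m n m′ n′} → (Fin m → Fin m′) → (Fin n → Fin n′) → Tm m n → Tm m′ n′
ren ρ θ (lvar a)      = lvar (θ a)
ren ρ θ (uvar u)      = uvar (ρ u)
ren ρ θ ⟨ t , s ⟩     = ⟨ ren ρ θ t , ren ρ θ s ⟩
ren ρ θ (t [⟨⟩≔ s ])  = ren ρ (lift 2 θ) t [⟨⟩≔ ren ρ θ s ]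
ren ρ θ (⅋λ t)        = ⅋λ ren ρ (lift 2 θ) t
ren ρ θ (t • s)       = ren ρ θ t • ren ρ θ s
ren ρ θ (t ▾ s)       = ren ρ θ t ▾ ren ρ θ s
ren ρ θ (!λ t)        = !λ ren ρ (lift 1 θ) t
ren ρ θ (t [!≔ s ])   = ren (lift 1 ρ) θ t [!≔ ren ρ θ s ]
ren ρ θ (?λ t)        = ?λ ren (lift 1 ρ) θ t
ren ρ θ (t ▶ s)       = ren ρ (lift 1 θ) t ▶ ren ρ θ s
ren ρ θ (t ♯ s)       = ren ρ θ t ♯ ren ρ θ s
ren ρ θ ⋆             = ⋆
ren ρ θ (t [⋆≔ s ])   = ren ρ θ t [⋆≔ ren ρ θ s ]

wkˡ : ∀ {m n} → Tm m n → Tm m (1 + n)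
wkˡ = ren id suc

wkᵘ : ∀ {m n} → Tm m n → Tm (1 + m) n
wkᵘ = ren suc id

module _ {m n : ℕ} where

  bindˡ : ∀ {k} → (Fin k → Tm m n) → Fin (1 + k) → Tm m (1 + n)
  bindˡ σ zero    = lvar zero
  bindˡ σ (suc a) = wkˡ (σ a)

  bindᵘ : ∀ {k} → (Fin k → Tm m n) → Fin (1 + k) → Tm (1 + m) n
  bindᵘ σ zero    = uvar zero
  bindᵘ σ (suc u) = wkᵘ (σ u)

sub : ∀ {m n m′ n′} →
      (Fin m → Tm m′ n′) → (Fin n → Tm m′ n′) → Tm m n → Tm m′ n′
sub σ τ (lvar a)      = τ a
sub σ τ (uvar u)      = σ u
sub σ τ ⟨ t , s ⟩     = ⟨ sub σ τ t , sub σ τ s ⟩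
sub σ τ (t [⟨⟩≔ s ])  =
  sub (wkˡ ∘ wkˡ ∘ σ) (bindˡ (bindˡ τ)) t [⟨⟩≔ sub σ τ s ]
sub σ τ (⅋λ t)        = ⅋λ sub (wkˡ ∘ wkˡ ∘ σ) (bindˡ (bindˡ τ)) t
sub σ τ (t • s)       = sub σ τ t • sub σ τ s
sub σ τ (t ▾ s)       = sub σ τ t ▾ sub σ τ s
sub σ τ (!λ t)        = !λ sub (wkˡ ∘ σ) (bindˡ τ) t
sub σ τ (t [!≔ s ])   = sub (bindᵘ σ) (wkᵘ ∘ τ) t [!≔ sub σ τ s ]
sub σ τ (?λ t)        = ?λ sub (bindᵘ σ) (wkᵘ ∘ τ) t
sub σ τ (t ▶ s)       = sub (wkˡ ∘ σ) (bindˡ τ) t ▶ sub σ τ s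
sub σ τ (t ♯ s)       = sub σ τ t ♯ sub σ τ s
sub σ τ ⋆             = ⋆
sub σ τ (t [⋆≔ s ])   = sub σ τ t [⋆≔ sub σ τ s ]

infixl 11 _⟦_≔_⟧ _⟦≔ᵘ_⟧

-- t{a:=s}; the variable a is removed from the scope.
_⟦_≔_⟧ : ∀ {m n} → Tm m (1 + n) → Fin (1 + n) → Tm m n → Tm m n
t ⟦ a ≔ s ⟧ = sub uvar (insertAt lvar a s) t

-- t{u:=s} for the most recently bound unrestricted variable u.
_⟦≔ᵘ_⟧ : ∀ {m n} → Tm (1 + m) n → Tm m n → Tm m n
t ⟦≔ᵘ s ⟧ = sub (insertAt uvar zero s) lvar t

_∈fv_ : ∀ {m n} → Fin n → Tm m n → Bool
a ∈fv lvar b       = does (a ≟ b)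
a ∈fv uvar u       = false
a ∈fv ⟨ t , s ⟩    = a ∈fv t ∨ a ∈fv s
a ∈fv (t [⟨⟩≔ s ]) = suc (suc a) ∈fv t ∨ a ∈fv s
a ∈fv (⅋λ t)       = suc (suc a) ∈fv t
a ∈fv (t • s)      = a ∈fv t ∨ a ∈fv s
a ∈fv (t ▾ s)      = a ∈fv t ∨ a ∈fv s
a ∈fv (!λ t)       = suc a ∈fv t
a ∈fv (t [!≔ s ])  = a ∈fv t ∨ a ∈fv s
a ∈fv (?λ t)       = a ∈fv t
a ∈fv (t ▶ s)      = suc a ∈fv t ∨ a ∈fv s
a ∈fv (t ♯ s)      = a ∈fv t ∨ a ∈fv s
a ∈fv ⋆            = false
a ∈fv (t [⋆≔ s ])  = a ∈fv t ∨ a ∈fv s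

-- t{a\\s}.  It is only meaningful for linear t with a free in t, and
-- whenever a is declared in the linear context of a typable t both hold.
-- So the second case of a binary constructor is that of a free in t₂, the
-- clause for lvar is that of a itself, and the values for uvar, !λ and ⋆
-- (which have no free linear variables) are arbitrary.  The result stays in
-- the scope of t, although a no longer occurs in it (unless it does in s).
_⟪_\\_⟫ : ∀ {m n} → Tm m n → Fin n → Tm m n → Tm m n
lvar _ ⟪ a \\ s ⟫ = s
⟨ t₁ , t₂ ⟩ ⟪ a \\ s ⟫ =
  if a ∈fv t₁ then t₁ ⟪ a \\ s ▾ t₂ ⟫
              else t₂ ⟪ a \\ s • t₁ ⟫
(t₁ • t₂) ⟪ a \\ s ⟫ =
  if a ∈fv t₁ then t₁ ⟪ a \\ ⟨ t₂ , s ⟩ ⟫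
              else t₂ ⟪ a \\ t₁ ▾ s ⟫
(t₁ ▾ t₂) ⟪ a \\ s ⟫ =
  if a ∈fv t₁ then t₁ ⟪ a \\ ⟨ s , t₂ ⟩ ⟫
              else t₂ ⟪ a \\ t₁ • s ⟫
(t₁ [⟨⟩≔ t₂ ]) ⟪ a \\ s ⟫ =
  if suc (suc a) ∈fv t₁
  then (t₁ ⟪ suc (suc a) \\ wkˡ (wkˡ s) ⟫) [⟨⟩≔ t₂ ]
  else t₂ ⟪ a \\ ⅋λ (t₁ ♯ wkˡ (wkˡ s)) ⟫
(⅋λ t) ⟪ a \\ s ⟫ = (t ⟪ suc (suc a) \\ ⋆ ⟫) [⟨⟩≔ s ]
(t₁ [!≔ t₂ ]) ⟪ a \\ s ⟫ =
  if a ∈fv t₁ then (t₁ ⟪ a \\ wkᵘ s ⟫) [!≔ t₂ ]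
              else t₂ ⟪ a \\ ?λ (t₁ ♯ wkᵘ s) ⟫
(?λ t) ⟪ a \\ s ⟫ = (t ⟪ a \\ ⋆ ⟫) [!≔ s ]
(t₁ ▶ t₂) ⟪ a \\ s ⟫ = (t₂ ⟪ a \\ !λ t₁ ⟫) [⋆≔ s ]
(t₁ ♯ t₂) ⟪ a \\ s ⟫ =
  if a ∈fv t₁ then (t₁ ⟪ a \\ t₂ ⟫) [⋆≔ s ]
              else (t₂ ⟪ a \\ t₁ ⟫) [⋆≔ s ]
(t₁ [⋆≔ t₂ ]) ⟪ a \\ s ⟫ =
  if a ∈fv t₁ then (t₁ ⟪ a \\ s ⟫) [⋆≔ t₂ ]
              else t₂ ⟪ a \\ t₁ ♯ s ⟫
uvar _ ⟪ a \\ s ⟫ = s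
(!λ _) ⟪ a \\ s ⟫ = s
⋆ ⟪ a \\ s ⟫ = s

infixl 11 _⟪\\⋆⟫

-- t{a\\⋆} for the most recently bound linear variable a.  Since a does not
-- occur in the contra-substitution, the outer substitution only removes it
-- from the scope.
_⟪\\⋆⟫ : ∀ {m n} → Tm m (1 + n) → Tm m n
t ⟪\\⋆⟫ = (t ⟪ zero \\ ⋆ ⟫) ⟦ zero ≔ ⋆ ⟧

-- p ▷ m is p + m, computed so that the scope at the hole of a context,
-- whose outermost binder comes first, needs no transport.
infixr 6 _▷_

_▷_ : ℕ → ℕ → ℕ
zero  ▷ m = m
suc p ▷ m = p ▷ suc m

shift : ∀ p {m} → Fin m → Fin (p ▷ m)
shift zero    i = i
shift (suc p) i = shift p (suc i)

lift▷ : ∀ p {m m′} → (Fin m → Fin m′) → Fin (p ▷ m) → Fin (p ▷ m′)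
lift▷ zero    ρ = ρ
lift▷ (suc p) ρ = lift▷ p (lift 1 ρ)

-- A context in scope (m , n) binding p unrestricted and q linear variables
-- at its hole.
data ECtx (m n : ℕ) : ℕ → ℕ → Set where
  □       : ECtx m n 0 0
  _[⟨⟩≔_] : ∀ {p q} → ECtx m (2 + n) p q → Tm m n → ECtx m n p (2 + q)
  _[!≔_]  : ∀ {p q} → ECtx (1 + m) n p q → Tm m n → ECtx m n (1 + p) q
  _[⋆≔_]  : ∀ {p q} → ECtx m n p q → Tm m n → ECtx m n p q

infixl 10 _⟨_⟩

_⟨_⟩ : ∀ {m n p q} → Tm (p ▷ m) (q ▷ n) → ECtx m n p q → Tm m n
t ⟨ □ ⟩           = t
t ⟨ L [⟨⟩≔ s ] ⟩  = t ⟨ L ⟩ [⟨⟩≔ s ]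
t ⟨ L [!≔ s ] ⟩   = t ⟨ L ⟩ [!≔ s ]
t ⟨ L [⋆≔ s ] ⟩   = t ⟨ L ⟩ [⋆≔ s ]

renᴸ : ∀ {m n m′ n′ p q} → (Fin m → Fin m′) → (Fin n → Fin n′) →
       ECtx m n p q → ECtx m′ n′ p q
renᴸ ρ θ □            = □
renᴸ ρ θ (L [⟨⟩≔ s ]) = renᴸ ρ (lift 2 θ) L [⟨⟩≔ ren ρ θ s ]
renᴸ ρ θ (L [!≔ s ])  = renᴸ (lift 1 ρ) θ L [!≔ ren ρ θ s ]
renᴸ ρ θ (L [⋆≔ s ])  = renᴸ ρ θ L [⋆≔ ren ρ θ s ]

-- The renamings express that a term moved into the hole of a context is
-- not captured by it, and likewise for a context L nested inside K.
-- t ⟦ suc zero ≔ wkˡ s ⟧ ⟦ zero ≔ r ⟧ is t{a:=s}{b:=r} with b ∉ fv(s).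
infix 3 _↦_ _→⁻_

data _↦_ {m n : ℕ} : Tm m n → Tm m n → Set where

  ⅋• : ∀ {p q} (L : ECtx m n p q) t r →
       (⅋λ t) ⟨ L ⟩ • r
         ↦ t ⟦ suc zero ≔ wkˡ (ren (shift p) (shift q) r) ⟧ ⟪\\⋆⟫ ⟨ L ⟩

  ⅋▾ : ∀ {p q} (L : ECtx m n p q) t r →
       (⅋λ t) ⟨ L ⟩ ▾ r
         ↦ t ⟦ zero ≔ wkˡ (ren (shift p) (shift q) r) ⟧ ⟪\\⋆⟫ ⟨ L ⟩

  ⊗β : ∀ {p q} (L : ECtx m n p q) t s r →
       t [⟨⟩≔ ⟨ s , r ⟩ ⟨ L ⟩ ]
         ↦ ren (shift p) (lift 2 (shift q)) t
             ⟦ suc zero ≔ wkˡ s ⟧ ⟦ zero ≔ r ⟧ ⟨ L ⟩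

  !β : ∀ {p q} (L : ECtx m n p q) t s →
       t [!≔ (!λ s) ⟨ L ⟩ ]
         ↦ ren (lift 1 (shift p)) (shift q) t ⟦≔ᵘ s ⟪\\⋆⟫ ⟧ ⟨ L ⟩

  ?β : ∀ {p q} (L : ECtx m n p q) t s →
       t ▶ (?λ s) ⟨ L ⟩
         ↦ s ⟦≔ᵘ ren (shift p) (lift 1 (shift q)) t ⟪\\⋆⟫ ⟧ ⟨ L ⟩

  ⅋♯⊗ : ∀ {p q p′ q′} (L : ECtx m n p q) (K : ECtx m n p′ q′) t s r →
        (⅋λ t) ⟨ L ⟩ ♯ ⟨ s , r ⟩ ⟨ K ⟩
          ↦ ren (lift▷ p (shift p′)) (lift 2 (lift▷ q (shift q′))) t
              ⟦ suc zero ≔ wkˡ (ren (shift p) (shift q) s) ⟧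
              ⟦ zero ≔ ren (shift p) (shift q) r ⟧
              ⟨ renᴸ (shift p′) (shift q′) L ⟩ ⟨ K ⟩

  ⊗♯⅋ : ∀ {p q p′ q′} (L : ECtx m n p q) (K : ECtx m n p′ q′) t s r →
        ⟨ s , r ⟩ ⟨ L ⟩ ♯ (⅋λ t) ⟨ K ⟩
          ↦ ren (shift p) (lift 2 (shift q)) t
              ⟦ suc zero ≔ wkˡ (ren (lift▷ p (shift p′)) (lift▷ q (shift q′)) s) ⟧
              ⟦ zero ≔ ren (lift▷ p (shift p′)) (lift▷ q (shift q′)) r ⟧
              ⟨ renᴸ (shift p′) (shift q′) L ⟩ ⟨ K ⟩

  !♯? : ∀ {p q p′ q′} (L : ECtx m n p q) (K : ECtx m n p′ q′) t r →
        (!λ t) ⟨ L ⟩ ♯ (?λ r) ⟨ K ⟩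
          ↦ ren (lift 1 (shift p)) (shift q) r
              ⟦≔ᵘ ren (lift▷ p (shift p′)) (lift 1 (lift▷ q (shift q′))) t ⟪\\⋆⟫ ⟧
              ⟨ renᴸ (shift p′) (shift q′) L ⟩ ⟨ K ⟩

  ?♯! : ∀ {p q p′ q′} (L : ECtx m n p q) (K : ECtx m n p′ q′) t r →
        (?λ r) ⟨ L ⟩ ♯ (!λ t) ⟨ K ⟩
          ↦ ren (lift 1 (lift▷ p (shift p′))) (lift▷ q (shift q′)) r
              ⟦≔ᵘ ren (shift p) (lift 1 (shift q)) t ⟪\\⋆⟫ ⟧
              ⟨ renᴸ (shift p′) (shift q′) L ⟩ ⟨ K ⟩

data _→⁻_ {m n : ℕ} : Tm m n → Tm m n → Set where

  axiom : ∀ {t t′ Δ Γ A} →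
          t ↦ t′ → Δ ﹔ Γ ⊢ t ∶ A → Δ ﹔ Γ ⊢ t′ ∶ A → t →⁻ t′

  ⟨-,⟩   : ∀ {t t′ s} → t →⁻ t′ → ⟨ t , s ⟩ →⁻ ⟨ t′ , s ⟩
  ⟨,-⟩   : ∀ {t s s′} → s →⁻ s′ → ⟨ t , s ⟩ →⁻ ⟨ t , s′ ⟩
  -[⟨⟩≔] : ∀ {t t′ s} → t →⁻ t′ → t [⟨⟩≔ s ] →⁻ t′ [⟨⟩≔ s ]
  [⟨⟩≔-] : ∀ {t s s′} → s →⁻ s′ → t [⟨⟩≔ s ] →⁻ t [⟨⟩≔ s′ ]
  ⅋λ-    : ∀ {t t′} → t →⁻ t′ → ⅋λ t →⁻ ⅋λ t′
  -•     : ∀ {t t′ s} → t →⁻ t′ → t • s →⁻ t′ • s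
  •-     : ∀ {t s s′} → s →⁻ s′ → t • s →⁻ t • s′
  -▾     : ∀ {t t′ s} → t →⁻ t′ → t ▾ s →⁻ t′ ▾ s
  ▾-     : ∀ {t s s′} → s →⁻ s′ → t ▾ s →⁻ t ▾ s′
  !λ-    : ∀ {t t′} → t →⁻ t′ → !λ t →⁻ !λ t′
  -[!≔]  : ∀ {t t′ s} → t →⁻ t′ → t [!≔ s ] →⁻ t′ [!≔ s ]
  [!≔-]  : ∀ {t s s′} → s →⁻ s′ → t [!≔ s ] →⁻ t [!≔ s′ ]
  ?λ-    : ∀ {t t′} → t →⁻ t′ → ?λ t →⁻ ?λ t′
  -▶     : ∀ {t t′ s} → t →⁻ t′ → t ▶ s →⁻ t′ ▶ s
  ▶-     : ∀ {t s s′} → s →⁻ s′ → t ▶ s →⁻ t ▶ s′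
  -♯     : ∀ {t t′ s} → t →⁻ t′ → t ♯ s →⁻ t′ ♯ s
  ♯-     : ∀ {t s s′} → s →⁻ s′ → t ♯ s →⁻ t ♯ s′
  -[⋆≔]  : ∀ {t t′ s} → t →⁻ t′ → t [⋆≔ s ] →⁻ t′ [⋆≔ s ]
  [⋆≔-]  : ∀ {t s s′} → s →⁻ s′ → t [⋆≔ s ] →⁻ t [⋆≔ s′ ]

{-# OPTIONS --safe #-}
module Submission where

-- Every typable term gets a derivation W ⊩ t ∶ x in an untyped, non-idempotent
-- "relational" type system.  The point x is a possible result of an experiment
-- on the proof net of t (a formula and its dual have the same points), and W is
-- the multiset of variable occurrences and units of fuel that the experiment
-- consumes.  Exponentials are explored at nonempty bags of points, so even a box
-- that will be erased is visited.  Substitution and contra-substitution do not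
-- create fuel, hence every step burns some, and derivability implies strong
-- normalization.  That typable terms are derivable involves no reduction:
-- formulae denote biorthogonally closed families of sets of points, where two
-- sets are orthogonal when they meet, and a term sends sets in the families of
-- its variables to a set in the family of its type.

open import Defs
open import Data.Bool.Base using (true; false; _∨_)
open import Data.Bool.Properties using (∨-zeroʳ)
import Data.Empty as Empty
open import Data.Empty using (⊥-elim)
open import Data.Fin.Base using (Fin; zero; suc; lift)
open import Data.Fin.Properties using (_≟_)
open import Data.List.Base using (List; []; _∷_; _++_; map; length)
open import Data.List.Properties using (map-++; map-∘; map-cong; map-id)
import Data.List.Properties as Lₚ
open import Data.List.Membership.Propositional using (_∈_)
open import Data.List.Membership.Propositional.Properties
  using (∈-∃++; ∈-++⁻; ∈-++⁺ʳ; ∈-map⁻; ∈-map⁺)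
open import Data.List.Relation.Binary.Permutation.Propositional
  using (_↭_; refl; prep; swap; trans; ↭-sym; ↭-reflexive)
open import Data.List.Relation.Binary.Permutation.Propositional.Properties
  using (All-resp-↭; ∈-resp-↭; ↭-length; map⁺; ++⁺; ++⁺ˡ; ++⁺ʳ; drop-∷;
         ++-assoc; ++-comm; ++-identityʳ; shifts; ++-commutativeMonoid)
  renaming (shift to ↭-shift)
open import Data.List.Relation.Unary.All as All using (All; []; _∷_)
import Data.List.Relation.Unary.All.Properties as Allₚ
open import Data.List.Relation.Unary.Any using (here; there)
open import Data.Maybe.Base using (just; nothing)
open import Data.Nat.Base using (ℕ; zero; suc; _+_; _≤_; s≤s)
open import Data.Nat.Properties using (≤-trans; ≤-refl; ≤-reflexive)
open import Data.Product.Base using (_×_; _,_; proj₁; proj₂; Σ-syntax; ∃-syntax; ∃)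
open import Data.Sum.Base using (inj₁; inj₂)
open import Data.Unit.Base using (⊤; tt)
open import Data.Vec.Base using ([]; _∷_; lookup)
open import Data.Vec.Functional using (insertAt)
open import Function.Base using (id; _∘_)
open import Relation.Binary.PropositionalEquality
  using (_≡_; _≢_; refl; sym; cong; cong₂; subst; subst₂)
  renaming (trans to ≡-trans)
open import Relation.Nullary using (¬_)
open import Relation.Nullary.Decidable using (dec-true; dec-false)

-- Points, resources and the relational type system

private variable
  m n m′ n′ p q : ℕ

-- One constructor per pair of dual connectives, since a cut asks both sides for the same point: `∗`
-- serves atoms and units, `_∙_` the multiplicatives, `bag` the exponentials.
data Pt : Set where
  ∗   : Pt
  _∙_ : Pt → Pt → Pt
  bag : List Pt → Pt

private variable
  x y z : Pt
  M : List Pt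

data Tok (m n : ℕ) : Set where
  fuel : Tok m n
  lin  : Fin n → Pt → Tok m n
  unr  : Fin m → Pt → Tok m n

Res : ℕ → ℕ → Set
Res m n = List (Tok m n)

private variable
  U V W W₀ W₁ W₂ V₁ V₂ H H′ J R : Res m n
  t s r t′ s′ : Tm m n
  e : Tok m n

-- Only free tokens may be left over: linear variables occur exactly once.
data Free {m n} : Tok m n → Set where
  fuel : Free fuel
  unr  : ∀ {u x} → Free (unr u x)

renTok : (Fin m → Fin m′) → (Fin n → Fin n′) → Tok m n → Tok m′ n′
renTok ρ θ fuel      = fuel
renTok ρ θ (lin a x) = lin (θ a) x
renTok ρ θ (unr u x) = unr (ρ u) x

wkˡ* : Res m n → Res m (suc n)
wkˡ* = map (renTok id suc)

wkᵘ* : Res m n → Res (suc m) n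
wkᵘ* = map (renTok suc id)

infixr 5 _▹_ _▹ᵘ_

_▹_ : Pt → Res m n → Res m (suc n)
x ▹ W = lin zero x ∷ wkˡ* W

_▹ᵘ_ : List Pt → Res m n → Res (suc m) n
M ▹ᵘ W = map (unr zero) M ++ wkᵘ* W

-- The costs make contra-substitution conserve fuel.  It turns _[⋆≔_] into ♯,
-- and _[⟨⟩≔_] into ⅋λ together with ♯, and ⅋λ into _[⟨⟩≔_] together with ⋆;
-- this forces ♯, ⋆ and _[⋆≔_] to cost nothing.
infix 3 _⊩_∶_ _⊩ᵇ_∶_

data _⊩_∶_ {m n} : Res m n → Tm m n → Pt → Set
data _⊩ᵇ_∶_ {m n} : Res m n → Tm m (suc n) → List Pt → Set

data _⊩_∶_ {m} {n} where
  lax : ∀ {a} → W ↭ lin a x ∷ J → All Free J → W ⊩ lvar a ∶ x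
  uax : ∀ {u} → W ↭ unr u x ∷ J → All Free J → W ⊩ uvar u ∶ x
  ⊗I  : W ↭ fuel ∷ W₁ ++ W₂ → W₁ ⊩ t ∶ x → W₂ ⊩ s ∶ y → W ⊩ ⟨ t , s ⟩ ∶ x ∙ y
  ⊗E  : W ↭ fuel ∷ W₁ ++ W₂ → W₁ ⊩ s ∶ x ∙ y → y ▹ x ▹ W₂ ⊩ t ∶ z → W ⊩ t [⟨⟩≔ s ] ∶ z
  ⅋I  : W ↭ fuel ∷ W₁ → y ▹ x ▹ W₁ ⊩ t ∶ ∗ → W ⊩ ⅋λ t ∶ x ∙ y
  ⅋E₁ : W ↭ fuel ∷ W₁ ++ W₂ → W₁ ⊩ t ∶ x ∙ y → W₂ ⊩ s ∶ x → W ⊩ t • s ∶ y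
  ⅋E₂ : W ↭ fuel ∷ W₁ ++ W₂ → W₁ ⊩ t ∶ x ∙ y → W₂ ⊩ s ∶ y → W ⊩ t ▾ s ∶ x
  !I  : W ↭ fuel ∷ W₁ → W₁ ⊩ᵇ t ∶ M → W ⊩ !λ t ∶ bag M
  !E  : W ↭ fuel ∷ W₁ ++ W₂ → W₁ ⊩ s ∶ bag M → M ▹ᵘ W₂ ⊩ t ∶ x → W ⊩ t [!≔ s ] ∶ x
  ?I  : W ↭ fuel ∷ W₁ → M ▹ᵘ W₁ ⊩ t ∶ ∗ → W ⊩ ?λ t ∶ bag M
  ?E  : W ↭ fuel ∷ W₁ ++ W₂ → W₁ ⊩ s ∶ bag M → W₂ ⊩ᵇ t ∶ M → W ⊩ t ▶ s ∶ ∗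
  cut : W ↭ W₁ ++ W₂ → W₁ ⊩ t ∶ x → W₂ ⊩ s ∶ x → W ⊩ t ♯ s ∶ ∗
  𝟏I  : All Free W → W ⊩ ⋆ ∶ ∗
  𝟏E  : W ↭ W₁ ++ W₂ → W₁ ⊩ s ∶ ∗ → W₂ ⊩ t ∶ x → W ⊩ t [⋆≔ s ] ∶ x

-- A box is run once for each point of the bag, each run using free tokens only. There is no
-- constructor for the empty bag, so some run always witnesses the body and pays for the steps
-- inside it.
data _⊩ᵇ_∶_ {m} {n} where
  last   : All Free W × (x ▹ W ⊩ t ∶ ∗) → W ⊩ᵇ t ∶ (x ∷ [])
  _∷⟨_⟩_ : All Free W₁ × (x ▹ W₁ ⊩ t ∶ ∗) → W ↭ W₁ ++ W₂ → W₂ ⊩ᵇ t ∶ M → W ⊩ᵇ t ∶ (x ∷ M)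

-- Resources up to permutation

module _ {A : Set} where

  open import Algebra.Solver.CommutativeMonoid (++-commutativeMonoid {A = A})
    using (solve; _⊜_; _⊕_)

  ↭-front : {a : A} {xs : List A} → a ∈ xs → ∃[ ys ] xs ↭ a ∷ ys
  ↭-front a∈xs with ∈-∃++ a∈xs
  ... | ys , zs , refl = ys ++ zs , ↭-shift _ ys zs

  -- These regroupings follow a binary rule: `fs` is its cost, `xs` and `ys` are its premises. In
  -- the first three, `vs` belongs to the term pushed inwards by contra-substitution; in the `burn`
  -- pair, `c` is the fuel spent by one premise.
  insert₁ : ∀ {us ws} (fs xs ys vs : List A) → us ↭ ws ++ vs → ws ↭ fs ++ xs ++ ys →
            us ↭ xs ++ (fs ++ vs ++ ys)
  insert₁ fs xs ys vs p q = trans p (trans (++⁺ʳ vs q)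
    (solve 4 (λ f x y v → (f ⊕ (x ⊕ y)) ⊕ v ⊜ x ⊕ (f ⊕ (v ⊕ y))) refl fs xs ys vs))

  insert₂ : ∀ {us ws} (fs xs ys vs : List A) → us ↭ ws ++ vs → ws ↭ fs ++ xs ++ ys →
            us ↭ ys ++ (fs ++ vs ++ xs)
  insert₂ fs xs ys vs p q = trans p (trans (++⁺ʳ vs q)
    (solve 4 (λ f x y v → (f ⊕ (x ⊕ y)) ⊕ v ⊜ y ⊕ (f ⊕ (v ⊕ x))) refl fs xs ys vs))

  append₂ : ∀ {us ws} (fs xs ys vs : List A) → us ↭ ws ++ vs → ws ↭ fs ++ xs ++ ys →
            us ↭ fs ++ xs ++ (ys ++ vs)
  append₂ fs xs ys vs p q = trans p (trans (++⁺ʳ vs q)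
    (solve 4 (λ f x y v → (f ⊕ (x ⊕ y)) ⊕ v ⊜ f ⊕ (x ⊕ (y ⊕ v))) refl fs xs ys vs))

  burn₁ : ∀ {ws xs xs′} {c : A} (fs ys : List A) → ws ↭ fs ++ xs ++ ys → xs ↭ c ∷ xs′ →
          ws ↭ c ∷ (fs ++ xs′ ++ ys)
  burn₁ {xs′ = xs′} {c} fs ys p q = trans p (trans (++⁺ˡ fs (++⁺ʳ ys q)) (↭-shift c fs (xs′ ++ ys)))

  burn₂ : ∀ {ws ys ys′} {c : A} (fs xs : List A) → ws ↭ fs ++ xs ++ ys → ys ↭ c ∷ ys′ →
          ws ↭ c ∷ (fs ++ xs ++ ys′)
  burn₂ {ys′ = ys′} {c} fs xs p q = trans p
    (trans (++⁺ˡ fs (trans (++⁺ˡ xs q) (↭-shift c xs ys′))) (↭-shift c fs (xs ++ ys′)))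

free-ren : {ρ : Fin m → Fin m′} {θ : Fin n → Fin n′} →
           All Free W → All Free (map (renTok ρ θ) W)
free-ren = Allₚ.gmap⁺ λ { fuel → fuel ; unr → unr }

free-++ : W ↭ W₁ ++ W₂ → All Free W₁ → All Free W₂ → All Free W
free-++ p fs gs = All-resp-↭ (↭-sym p) (Allₚ.++⁺ fs gs)

▹-↭ : W ↭ V ++ U → x ▹ W ↭ wkˡ* V ++ x ▹ U
▹-↭ {V = V} {U} {x} p =
  trans (prep _ (trans (map⁺ _ p) (↭-reflexive (map-++ _ V U)))) (↭-sym (↭-shift _ (wkˡ* V) (wkˡ* U)))

▹ᵘ-↭ : ∀ M → W ↭ V ++ U → M ▹ᵘ W ↭ wkᵘ* V ++ M ▹ᵘ U
▹ᵘ-↭ {V = V} {U} M p =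
  trans (++⁺ˡ (map (unr zero) M) (trans (map⁺ _ p) (↭-reflexive (map-++ _ V U))))
        (shifts (map (unr zero) M) (wkᵘ* V))

-- The surplus `J` is handed to one premise at each rule (in a box, to its first run) until an axiom
-- or `𝟏I` absorbs it. Permutations are carried along, so exchange is the case of empty `J`.
weaken : W ↭ J ++ V → All Free J → V ⊩ t ∶ x → W ⊩ t ∶ x
weakenᵇ : W ↭ J ++ V → All Free J → V ⊩ᵇ t ∶ M → W ⊩ᵇ t ∶ M

weaken-↭ : ∀ F (J : Res m n) {W V W₁} → W ↭ J ++ V → V ↭ F ++ W₁ → W ↭ F ++ J ++ W₁
weaken-↭ F J {W₁ = W₁} p q = trans p (trans (++⁺ˡ J q) (shifts J F))

weaken-↭₁ : ∀ F (J : Res m n) {W V W₁ W₂} → W ↭ J ++ V → V ↭ F ++ W₁ ++ W₂ → W ↭ F ++ (J ++ W₁) ++ W₂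
weaken-↭₁ F J {W₁ = W₁} {W₂} p q =
  trans (weaken-↭ F J p q) (++⁺ˡ F (↭-sym (++-assoc J W₁ W₂)))

weaken {J = J} p f (lax {J = K} {a = a} q g) =
  lax (weaken-↭ (lin a _ ∷ []) J p q) (Allₚ.++⁺ f g)
weaken {J = J} p f (uax {J = K} {u = u} q g) =
  uax (weaken-↭ (unr u _ ∷ []) J p q) (Allₚ.++⁺ f g)
weaken {J = J} p f (⊗I q D E)  = ⊗I (weaken-↭₁ (fuel ∷ []) J p q) (weaken refl f D) E
weaken {J = J} p f (⊗E q D E)  = ⊗E (weaken-↭₁ (fuel ∷ []) J p q) (weaken refl f D) E
weaken {J = J} p f (⅋I q D)    =
  ⅋I (weaken-↭ (fuel ∷ []) J p q)
     (weaken (▹-↭ {V = wkˡ* J} (▹-↭ {V = J} refl)) (free-ren (free-ren f)) D)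
weaken {J = J} p f (⅋E₁ q D E) = ⅋E₁ (weaken-↭₁ (fuel ∷ []) J p q) (weaken refl f D) E
weaken {J = J} p f (⅋E₂ q D E) = ⅋E₂ (weaken-↭₁ (fuel ∷ []) J p q) (weaken refl f D) E
weaken {J = J} p f (!I q D)    = !I (weaken-↭ (fuel ∷ []) J p q) (weakenᵇ refl f D)
weaken {J = J} p f (!E q D E)  = !E (weaken-↭₁ (fuel ∷ []) J p q) (weaken refl f D) E
weaken {J = J} p f (?I {M = M} q D) =
  ?I (weaken-↭ (fuel ∷ []) J p q) (weaken (▹ᵘ-↭ {V = J} M refl) (free-ren f) D)
weaken {J = J} p f (?E q D E)  = ?E (weaken-↭₁ (fuel ∷ []) J p q) (weaken refl f D) E
weaken {J = J} p f (cut q D E) = cut (weaken-↭₁ [] J p q) (weaken refl f D) E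
weaken p f (𝟏I g)              = 𝟏I (free-++ p f g)
weaken {J = J} p f (𝟏E q D E)  = 𝟏E (weaken-↭₁ [] J p q) (weaken refl f D) E

weakenᵇ {J = J} p f (last (g , D)) = last (free-++ p f g , weaken (▹-↭ {V = J} p) (free-ren f) D)
weakenᵇ {J = J} p f ((g , D) ∷⟨ q ⟩ E) =
  (Allₚ.++⁺ f g , weaken (▹-↭ {V = J} refl) (free-ren f) D) ∷⟨ weaken-↭₁ [] J p q ⟩ E

exchange : W ↭ V → V ⊩ t ∶ x → W ⊩ t ∶ x
exchange p = weaken {J = []} p []

-- Renaming and substitution

map-comm : ∀ {A B C D : Set} {f : B → D} {g : A → B} {h : C → D} {k : A → C} →
           (∀ a → f (g a) ≡ h (k a)) → ∀ as → map f (map g as) ≡ map h (map k as)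
map-comm eq as = ≡-trans (sym (map-∘ as)) (≡-trans (map-cong eq as) (map-∘ as))

module _ {ρ : Fin m → Fin m′} {θ : Fin n → Fin n′} where

  ren-wkˡ : ∀ (W : Res m n) →
            map (renTok ρ (lift 1 θ)) (wkˡ* W) ≡ wkˡ* (map (renTok ρ θ) W)
  ren-wkˡ = map-comm λ { fuel → refl ; (lin _ _) → refl ; (unr _ _) → refl }

  ren-wkᵘ : ∀ (W : Res m n) →
            map (renTok (lift 1 ρ) θ) (wkᵘ* W) ≡ wkᵘ* (map (renTok ρ θ) W)
  ren-wkᵘ = map-comm λ { fuel → refl ; (lin _ _) → refl ; (unr _ _) → refl }

  ren-▹ : ∀ (W : Res m n) → map (renTok ρ (lift 1 θ)) (x ▹ W) ≡ x ▹ map (renTok ρ θ) W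
  ren-▹ W = cong (lin zero _ ∷_) (ren-wkˡ W)

  ren-▹▹ : ∀ (W : Res m n) →
           map (renTok ρ (lift 2 θ)) (y ▹ x ▹ W) ≡ y ▹ x ▹ map (renTok ρ θ) W
  ren-▹▹ W = cong (λ V → lin zero _ ∷ lin (suc zero) _ ∷ V)
    (≡-trans (map-comm (λ { fuel → refl ; (lin _ _) → refl ; (unr _ _) → refl }) (wkˡ* W))
             (cong wkˡ* (ren-wkˡ W)))

  ren-▹ᵘ : ∀ M (W : Res m n) →
           map (renTok (lift 1 ρ) θ) (M ▹ᵘ W) ≡ M ▹ᵘ map (renTok ρ θ) W
  ren-▹ᵘ M W = ≡-trans (map-++ _ (map (unr zero) M) (wkᵘ* W))
                       (cong₂ _++_ (sym (map-∘ M)) (ren-wkᵘ W))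

map-↭-++ : ∀ {A B : Set} (f : A → B) (xs ys zs : List A) {ws} →
           ws ↭ xs ++ ys ++ zs → map f ws ↭ map f xs ++ map f ys ++ map f zs
map-↭-++ f xs ys zs p = trans (map⁺ f p)
  (↭-reflexive (≡-trans (map-++ f xs (ys ++ zs)) (cong (map f xs ++_) (map-++ f ys zs))))

cast-⊩ : V ≡ W → V ⊩ t ∶ x → W ⊩ t ∶ x
cast-⊩ refl D = D

renaming-⊩ : ∀ (ρ : Fin m → Fin m′) (θ : Fin n → Fin n′) →
             W ⊩ t ∶ x → map (renTok ρ θ) W ⊩ ren ρ θ t ∶ x
renaming-⊩ᵇ : ∀ (ρ : Fin m → Fin m′) (θ : Fin n → Fin n′) →
              W ⊩ᵇ t ∶ M → map (renTok ρ θ) W ⊩ᵇ ren ρ (lift 1 θ) t ∶ M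

renaming-⊩ ρ θ (lax p f) = lax (map⁺ _ p) (free-ren f)
renaming-⊩ ρ θ (uax p f) = uax (map⁺ _ p) (free-ren f)
renaming-⊩ ρ θ (⊗I {W₁ = W₁} {W₂ = W₂} p D E) =
  ⊗I (map-↭-++ _ (fuel ∷ []) W₁ W₂ p) (renaming-⊩ ρ θ D) (renaming-⊩ ρ θ E)
renaming-⊩ ρ θ (⊗E {W₁ = W₁} {W₂ = W₂} p D E) =
  ⊗E (map-↭-++ _ (fuel ∷ []) W₁ W₂ p) (renaming-⊩ ρ θ D)
     (cast-⊩ (ren-▹▹ W₂) (renaming-⊩ ρ (lift 2 θ) E))
renaming-⊩ ρ θ (⅋I {W₁ = W₁} p D) =
  ⅋I (map⁺ _ p) (cast-⊩ (ren-▹▹ W₁) (renaming-⊩ ρ (lift 2 θ) D))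
renaming-⊩ ρ θ (⅋E₁ {W₁ = W₁} {W₂ = W₂} p D E) =
  ⅋E₁ (map-↭-++ _ (fuel ∷ []) W₁ W₂ p) (renaming-⊩ ρ θ D) (renaming-⊩ ρ θ E)
renaming-⊩ ρ θ (⅋E₂ {W₁ = W₁} {W₂ = W₂} p D E) =
  ⅋E₂ (map-↭-++ _ (fuel ∷ []) W₁ W₂ p) (renaming-⊩ ρ θ D) (renaming-⊩ ρ θ E)
renaming-⊩ ρ θ (!I p D) = !I (map⁺ _ p) (renaming-⊩ᵇ ρ θ D)
renaming-⊩ ρ θ (!E {W₁ = W₁} {W₂ = W₂} {M = M} p D E) =
  !E (map-↭-++ _ (fuel ∷ []) W₁ W₂ p) (renaming-⊩ ρ θ D)
     (cast-⊩ (ren-▹ᵘ M W₂) (renaming-⊩ (lift 1 ρ) θ E))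
renaming-⊩ ρ θ (?I {W₁ = W₁} {M = M} p D) =
  ?I (map⁺ _ p) (cast-⊩ (ren-▹ᵘ M W₁) (renaming-⊩ (lift 1 ρ) θ D))
renaming-⊩ ρ θ (?E {W₁ = W₁} {W₂ = W₂} p D E) =
  ?E (map-↭-++ _ (fuel ∷ []) W₁ W₂ p) (renaming-⊩ ρ θ D) (renaming-⊩ᵇ ρ θ E)
renaming-⊩ ρ θ (cut {W₁ = W₁} {W₂ = W₂} p D E) =
  cut (map-↭-++ _ [] W₁ W₂ p) (renaming-⊩ ρ θ D) (renaming-⊩ ρ θ E)
renaming-⊩ ρ θ (𝟏I f) = 𝟏I (free-ren f)
renaming-⊩ ρ θ (𝟏E {W₁ = W₁} {W₂ = W₂} p D E) =
  𝟏E (map-↭-++ _ [] W₁ W₂ p) (renaming-⊩ ρ θ D) (renaming-⊩ ρ θ E)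

renaming-⊩ᵇ ρ θ (last {W = W} (f , D)) =
  last (free-ren f , cast-⊩ (ren-▹ W) (renaming-⊩ ρ (lift 1 θ) D))
renaming-⊩ᵇ ρ θ (_∷⟨_⟩_ {W₁ = W₁} {W₂ = W₂} (f , D) p E) =
  (free-ren f , cast-⊩ (ren-▹ W₁) (renaming-⊩ ρ (lift 1 θ) D))
    ∷⟨ map-↭-++ _ [] W₁ W₂ p ⟩ renaming-⊩ᵇ ρ θ E

module _ (σ : Fin m → Tm m′ n′) (τ : Fin n → Tm m′ n′) where

  -- Fuel is realised by itself alone, so substitution creates none. An unrestricted occurrence may
  -- be left over or sit in a box, hence its realiser must itself use free tokens only.
  Realises : Tok m n → Res m′ n′ → Set
  Realises fuel      V = V ≡ fuel ∷ []
  Realises (lin a x) V = V ⊩ τ a ∶ x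
  Realises (unr u x) V = All Free V × (V ⊩ σ u ∶ x)

  -- One derivation per occurrence rather than per variable: occurrences of the same unrestricted
  -- variable may be at different points.
  data Subs : Res m n → Res m′ n′ → Set where
    []  : Subs [] []
    _∷_ : Realises e V₁ → Subs W V₂ → Subs (e ∷ W) (V₁ ++ V₂)

module _ {σ : Fin m → Tm m′ n′} {τ : Fin n → Tm m′ n′} where

  subs-↭ : W ↭ W₁ → Subs σ τ W V → ∃[ V₁ ] V ↭ V₁ × Subs σ τ W₁ V₁
  subs-↭ refl ss = _ , refl , ss
  subs-↭ (prep e p) (_∷_ {V₁ = V₁} r ss) with subs-↭ p ss
  ... | _ , q , ss′ = _ , ++⁺ˡ V₁ q , r ∷ ss′
  subs-↭ (swap e e′ p) (_∷_ {V₁ = V₁} r (_∷_ {V₁ = V₂} r′ ss)) with subs-↭ p ss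
  ... | V , q , ss′ =
    _ , trans (++⁺ˡ V₁ (++⁺ˡ V₂ q)) (shifts V₁ V₂) , r′ ∷ (r ∷ ss′)
  subs-↭ (trans p p′) ss with subs-↭ p ss
  ... | _ , q , ss′ with subs-↭ p′ ss′
  ... | _ , q′ , ss″ = _ , trans q q′ , ss″

  subs-++⁻ : ∀ W₁ → Subs σ τ (W₁ ++ W₂) V →
             ∃[ V₁ ] ∃[ V₂ ] V ↭ V₁ ++ V₂ × Subs σ τ W₁ V₁ × Subs σ τ W₂ V₂
  subs-++⁻ [] ss = [] , _ , refl , [] , ss
  subs-++⁻ (e ∷ W₁) (_∷_ {V₁ = V} r ss) with subs-++⁻ W₁ ss
  ... | V₁ , V₂ , p , ss₁ , ss₂ =
    V ++ V₁ , V₂ , trans (++⁺ˡ V p) (↭-sym (++-assoc V V₁ V₂)) , r ∷ ss₁ , ss₂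

  subs-split : W ↭ W₁ ++ W₂ → Subs σ τ W V →
               ∃[ V₁ ] ∃[ V₂ ] V ↭ V₁ ++ V₂ × Subs σ τ W₁ V₁ × Subs σ τ W₂ V₂
  subs-split p ss with subs-↭ p ss
  ... | _ , q , ss′ with subs-++⁻ _ ss′
  ... | _ , _ , q′ , ss₁ , ss₂ = _ , _ , trans q q′ , ss₁ , ss₂

  subs-fuel : W ↭ fuel ∷ W₁ → Subs σ τ W V → ∃[ V₁ ] V ↭ fuel ∷ V₁ × Subs σ τ W₁ V₁
  subs-fuel p ss with subs-↭ p ss
  ... | _ , q , (refl ∷ ss′) = _ , q , ss′

  subs-fuel-split : W ↭ fuel ∷ W₁ ++ W₂ → Subs σ τ W V →
                    ∃[ V₁ ] ∃[ V₂ ] V ↭ fuel ∷ V₁ ++ V₂ × Subs σ τ W₁ V₁ × Subs σ τ W₂ V₂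
  subs-fuel-split p ss with subs-fuel p ss
  ... | _ , q , ss′ with subs-split refl ss′
  ... | _ , _ , q′ , ss₁ , ss₂ = _ , _ , trans q (prep _ q′) , ss₁ , ss₂

  subs-free : All Free W → Subs σ τ W V → All Free V
  subs-free [] [] = []
  subs-free (fuel ∷ fs) (refl ∷ ss) = fuel ∷ subs-free fs ss
  subs-free (unr ∷ fs) ((f , _) ∷ ss) = Allₚ.++⁺ f (subs-free fs ss)

  subs-wkˡ : Subs σ τ W V → Subs (wkˡ ∘ σ) (bindˡ τ) (wkˡ* W) (wkˡ* V)
  subs-wkˡ [] = []
  subs-wkˡ (_∷_ {e = e} {V₁ = V₁} {V₂ = V₂} r ss) =
    subst (Subs _ _ _) (sym (map-++ _ V₁ V₂)) (step e r ∷ subs-wkˡ ss)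
    where
    step : ∀ e {V} → Realises σ τ e V →
           Realises (wkˡ ∘ σ) (bindˡ τ) (renTok id suc e) (wkˡ* V)
    step fuel      refl    = refl
    step (lin a x) D       = renaming-⊩ id suc D
    step (unr u x) (f , D) = free-ren f , renaming-⊩ id suc D

  subs-▹ : Subs σ τ W V → Subs (wkˡ ∘ σ) (bindˡ τ) (x ▹ W) (x ▹ V)
  subs-▹ ss = _∷_ {V₁ = lin zero _ ∷ []} (lax refl []) (subs-wkˡ ss)

  subs-wkᵘ : Subs σ τ W V → Subs (bindᵘ σ) (wkᵘ ∘ τ) (wkᵘ* W) (wkᵘ* V)
  subs-wkᵘ [] = []
  subs-wkᵘ (_∷_ {e = e} {V₁ = V₁} {V₂ = V₂} r ss) =
    subst (Subs _ _ _) (sym (map-++ _ V₁ V₂)) (step e r ∷ subs-wkᵘ ss)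
    where
    step : ∀ e {V} → Realises σ τ e V →
           Realises (bindᵘ σ) (wkᵘ ∘ τ) (renTok suc id e) (wkᵘ* V)
    step fuel      refl    = refl
    step (lin a x) D       = renaming-⊩ suc id D
    step (unr u x) (f , D) = free-ren f , renaming-⊩ suc id D

  subs-▹ᵘ : ∀ M → Subs σ τ W V → Subs (bindᵘ σ) (wkᵘ ∘ τ) (M ▹ᵘ W) (M ▹ᵘ V)
  subs-▹ᵘ []      ss = subs-wkᵘ ss
  subs-▹ᵘ (x ∷ M) ss =
    _∷_ {V₁ = unr zero x ∷ []} (unr ∷ [] , uax refl []) (subs-▹ᵘ M ss)

-- Realisers are distributed to the premises exactly as the tokens they replace. At an axiom one
-- realiser becomes the result, and those of the leftover tokens are free, so weakening absorbs
-- them.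
substitution : ∀ {σ : Fin m → Tm m′ n′} {τ : Fin n → Tm m′ n′} →
               W ⊩ t ∶ x → Subs σ τ W V → V ⊩ sub σ τ t ∶ x
substitutionᵇ : ∀ {σ : Fin m → Tm m′ n′} {τ : Fin n → Tm m′ n′} →
                W ⊩ᵇ t ∶ M → Subs σ τ W V → V ⊩ᵇ sub (wkˡ ∘ σ) (bindˡ τ) t ∶ M

substitution (lax p f) ss with subs-↭ p ss
... | _ , q , _∷_ {V₁ = V₁} {V₂ = V₂} D ss′ =
  weaken (trans q (++-comm V₁ V₂)) (subs-free f ss′) D
substitution (uax p f) ss with subs-↭ p ss
... | _ , q , _∷_ {V₁ = V₁} {V₂ = V₂} (_ , D) ss′ =
  weaken (trans q (++-comm V₁ V₂)) (subs-free f ss′) D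
substitution (⊗I p D E) ss with subs-fuel-split p ss
... | _ , _ , q , ss₁ , ss₂ = ⊗I q (substitution D ss₁) (substitution E ss₂)
substitution (⊗E p D E) ss with subs-fuel-split p ss
... | _ , _ , q , ss₁ , ss₂ = ⊗E q (substitution D ss₁) (substitution E (subs-▹ (subs-▹ ss₂)))
substitution (⅋I p D) ss with subs-fuel p ss
... | _ , q , ss′ = ⅋I q (substitution D (subs-▹ (subs-▹ ss′)))
substitution (⅋E₁ p D E) ss with subs-fuel-split p ss
... | _ , _ , q , ss₁ , ss₂ = ⅋E₁ q (substitution D ss₁) (substitution E ss₂)
substitution (⅋E₂ p D E) ss with subs-fuel-split p ss
... | _ , _ , q , ss₁ , ss₂ = ⅋E₂ q (substitution D ss₁) (substitution E ss₂)
substitution (!I p D) ss with subs-fuel p ss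
... | _ , q , ss′ = !I q (substitutionᵇ D ss′)
substitution (!E {M = M} p D E) ss with subs-fuel-split p ss
... | _ , _ , q , ss₁ , ss₂ = !E q (substitution D ss₁) (substitution E (subs-▹ᵘ M ss₂))
substitution (?I {M = M} p D) ss with subs-fuel p ss
... | _ , q , ss′ = ?I q (substitution D (subs-▹ᵘ M ss′))
substitution (?E p D E) ss with subs-fuel-split p ss
... | _ , _ , q , ss₁ , ss₂ = ?E q (substitution D ss₁) (substitutionᵇ E ss₂)
substitution (cut p D E) ss with subs-split p ss
... | _ , _ , q , ss₁ , ss₂ = cut q (substitution D ss₁) (substitution E ss₂)
substitution (𝟏I f) ss = 𝟏I (subs-free f ss)
substitution (𝟏E p D E) ss with subs-split p ss
... | _ , _ , q , ss₁ , ss₂ = 𝟏E q (substitution D ss₁) (substitution E ss₂)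

substitutionᵇ (last (f , D)) ss = last (subs-free f ss , substitution D (subs-▹ ss))
substitutionᵇ ((f , D) ∷⟨ p ⟩ E) ss with subs-split p ss
... | _ , _ , q , ss₁ , ss₂ =
  (subs-free f ss₁ , substitution D (subs-▹ ss₁)) ∷⟨ q ⟩ substitutionᵇ E ss₂

-- Realises the tokens of the variables that a substitution merely renames, such as those other than
-- the one being replaced.
subs-var : ∀ {k l} {σ : Fin m → Tm m′ n′} {τ : Fin n → Tm m′ n′}
           {ρ : Fin k → Fin m} {θ : Fin l → Fin n} {ρ′ : Fin k → Fin m′} {θ′ : Fin l → Fin n′} →
           (∀ u → σ (ρ u) ≡ uvar (ρ′ u)) → (∀ a → τ (θ a) ≡ lvar (θ′ a)) →
           ∀ W → Subs σ τ (map (renTok ρ θ) W) (map (renTok ρ′ θ′) W)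
subs-var hu hl [] = []
subs-var hu hl (fuel ∷ W) = _∷_ {V₁ = fuel ∷ []} refl (subs-var hu hl W)
subs-var hu hl (lin a x ∷ W) =
  _∷_ {V₁ = lin _ _ ∷ []} (subst (_ ⊩_∶ x) (sym (hl a)) (lax refl [])) (subs-var hu hl W)
subs-var hu hl (unr u x ∷ W) =
  _∷_ {V₁ = unr _ _ ∷ []} (unr ∷ [] , subst (_ ⊩_∶ x) (sym (hu u)) (uax refl [])) (subs-var hu hl W)

map-renTok-id : ∀ (W : Res m n) → map (renTok id id) W ≡ W
map-renTok-id W = ≡-trans (map-cong (λ { fuel → refl ; (lin _ _) → refl ; (unr _ _) → refl }) W) (map-id W)

suc² : Fin n → Fin (suc (suc n))
suc² a = suc (suc a)

wkˡ*-wkˡ* : ∀ (W : Res m n) → map (renTok id (suc²)) W ≡ wkˡ* (wkˡ* W)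
wkˡ*-wkˡ* W = ≡-trans (map-cong (λ { fuel → refl ; (lin _ _) → refl ; (unr _ _) → refl }) W) (map-∘ W)

subst₀ : x ▹ H ⊩ t ∶ z → V ⊩ s ∶ x → H ++ V ⊩ t ⟦ zero ≔ s ⟧ ∶ z
subst₀ {H = H} {V = V} D E = exchange
  (trans (++-comm H V) (++⁺ˡ V (↭-reflexive (sym (map-renTok-id H)))))
  (substitution D (E ∷ subs-var (λ _ → refl) (λ _ → refl) H))

subst₁ : y ▹ x ▹ H ⊩ t ∶ z → V ⊩ s ∶ x → y ▹ (H ++ V) ⊩ t ⟦ suc zero ≔ wkˡ s ⟧ ∶ z
subst₁ {H = H} {V = V} D E = exchange
  (prep _ (trans (↭-reflexive (map-++ _ H V)) (++-comm (wkˡ* H) (wkˡ* V))))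
  (substitution D
    (_∷_ {V₁ = lin zero _ ∷ []} (lax refl [])
      (renaming-⊩ id suc E ∷
        subst (λ U → Subs _ _ U (wkˡ* H)) (wkˡ*-wkˡ* H)
          (subs-var {ρ = id} {θ = suc²} (λ _ → refl) (λ _ → refl) H))))

-- Contra-substitution

infix 4 _#_

data _#_ {m n} (a : Fin n) : Tok m n → Set where
  fuel : a # fuel
  unr  : ∀ {u x} → a # unr u x
  lin  : ∀ {b x} → a ≢ b → a # lin b x

private variable
  a : Fin n

free⇒# : All Free W → All (a #_) W
free⇒# = All.map λ { fuel → fuel ; unr → unr }

#-▹ : All (a #_) W → All (suc a #_) (x ▹ W)
#-▹ fs = lin (λ ()) ∷ Allₚ.gmap⁺ (λ { fuel → fuel ; unr → unr ; (lin ne) → lin λ { refl → ne refl } }) fs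

#-▹ᵘ : ∀ M → All (a #_) W → All (a #_) (M ▹ᵘ W)
#-▹ᵘ [] fs = Allₚ.gmap⁺ (λ { fuel → fuel ; unr → unr ; (lin ne) → lin ne }) fs
#-▹ᵘ (x ∷ M) fs = unr ∷ #-▹ᵘ M fs

lin∉free : lin a x ∈ W → ¬ All Free W
lin∉free a∈ fs with All.lookup fs a∈
... | ()

lin∈-▹ : lin a x ∈ W → lin (suc a) x ∈ y ▹ W
lin∈-▹ a∈ = there (∈-map⁺ _ a∈)

lin∈-▹ᵘ : ∀ M → lin a x ∈ W → lin a x ∈ M ▹ᵘ W
lin∈-▹ᵘ M a∈ = ∈-++⁺ʳ (map (unr zero) M) (∈-map⁺ _ a∈)

-- With `fv-true`, this lets the resources decide the tests `a ∈fv t` made by contra-substitution.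
-- For a box nothing is assumed of `W`: every run uses free tokens only, and there is at least one
-- run to inspect.
fv-false  : W ⊩ t ∶ x → All (a #_) W → a ∈fv t ≡ false
fv-falseᵇ : W ⊩ᵇ t ∶ M → suc a ∈fv t ≡ false

fv-false₂ : W₁ ⊩ t ∶ x → W₂ ⊩ s ∶ y → All (a #_) (W₁ ++ W₂) → a ∈fv t ∨ a ∈fv s ≡ false
fv-false₂ {W₁ = W₁} D E fs = cong₂ _∨_ (fv-false D (Allₚ.++⁻ˡ W₁ fs)) (fv-false E (Allₚ.++⁻ʳ W₁ fs))

fv-false {a = a} (lax {a = b} p _) fs with All-resp-↭ p fs
... | lin ne ∷ _ = dec-false (a ≟ b) ne
fv-false (uax p _) fs = refl
fv-false (⊗I p D E) fs with All-resp-↭ p fs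
... | _ ∷ gs = fv-false₂ D E gs
fv-false (⊗E {W₁ = W₁} p D E) fs with All-resp-↭ p fs
... | _ ∷ gs = cong₂ _∨_ (fv-false E (#-▹ (#-▹ (Allₚ.++⁻ʳ W₁ gs)))) (fv-false D (Allₚ.++⁻ˡ W₁ gs))
fv-false (⅋I p D) fs with All-resp-↭ p fs
... | _ ∷ gs = fv-false D (#-▹ (#-▹ gs))
fv-false (⅋E₁ p D E) fs with All-resp-↭ p fs
... | _ ∷ gs = fv-false₂ D E gs
fv-false (⅋E₂ p D E) fs with All-resp-↭ p fs
... | _ ∷ gs = fv-false₂ D E gs
fv-false (!I p D) fs = fv-falseᵇ D
fv-false (!E {W₁ = W₁} {M = M} p D E) fs with All-resp-↭ p fs
... | _ ∷ gs = cong₂ _∨_ (fv-false E (#-▹ᵘ M (Allₚ.++⁻ʳ W₁ gs))) (fv-false D (Allₚ.++⁻ˡ W₁ gs))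
fv-false (?I {M = M} p D) fs with All-resp-↭ p fs
... | _ ∷ gs = fv-false D (#-▹ᵘ M gs)
fv-false (?E {W₁ = W₁} p D E) fs with All-resp-↭ p fs
... | _ ∷ gs = cong₂ _∨_ (fv-falseᵇ E) (fv-false D (Allₚ.++⁻ˡ W₁ gs))
fv-false (cut p D E) fs = fv-false₂ D E (All-resp-↭ p fs)
fv-false (𝟏I _) fs = refl
fv-false (𝟏E {W₁ = W₁} p D E) fs with All-resp-↭ p fs
... | gs = cong₂ _∨_ (fv-false E (Allₚ.++⁻ʳ W₁ gs)) (fv-false D (Allₚ.++⁻ˡ W₁ gs))

fv-falseᵇ (last (f , D))     = fv-false D (#-▹ (free⇒# f))
fv-falseᵇ ((f , D) ∷⟨ p ⟩ E) = fv-falseᵇ E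

∨-trueˡ : ∀ {b c} → b ≡ true → b ∨ c ≡ true
∨-trueˡ refl = refl

∨-trueʳ : ∀ {b c} → c ≡ true → b ∨ c ≡ true
∨-trueʳ {b} refl = ∨-zeroʳ b

lin∈-fuel : W ↭ fuel ∷ V → lin a x ∈ W → lin a x ∈ V
lin∈-fuel p a∈ with ∈-resp-↭ p a∈
... | there a∈′ = a∈′

box-free : W ⊩ᵇ t ∶ M → All Free W
box-free (last (f , _))     = f
box-free ((f , _) ∷⟨ p ⟩ E) = free-++ p f (box-free E)

fv-true : W ⊩ t ∶ x → lin a y ∈ W → a ∈fv t ≡ true

fv-true₂ : W₁ ⊩ t ∶ x → W₂ ⊩ s ∶ z → lin a y ∈ W₁ ++ W₂ → a ∈fv t ∨ a ∈fv s ≡ true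
fv-true₂ {W₁ = W₁} D E a∈ with ∈-++⁻ W₁ a∈
... | inj₁ a∈₁ = ∨-trueˡ (fv-true D a∈₁)
... | inj₂ a∈₂ = ∨-trueʳ (fv-true E a∈₂)

fv-true {a = a} (lax {a = b} p f) a∈ with ∈-resp-↭ p a∈
... | here refl = dec-true (a ≟ a) refl
... | there a∈J = ⊥-elim (lin∉free a∈J f)
fv-true (uax p f) a∈ = ⊥-elim (lin∉free (∈-resp-↭ p a∈) (unr ∷ f))
fv-true (⊗I p D E) a∈ = fv-true₂ D E (lin∈-fuel p a∈)
fv-true (⊗E {W₁ = W₁} p D E) a∈ with ∈-++⁻ W₁ (lin∈-fuel p a∈)
... | inj₁ a∈₁ = ∨-trueʳ (fv-true D a∈₁)
... | inj₂ a∈₂ = ∨-trueˡ (fv-true E (lin∈-▹ (lin∈-▹ a∈₂)))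
fv-true (⅋I p D) a∈ = fv-true D (lin∈-▹ (lin∈-▹ (lin∈-fuel p a∈)))
fv-true (⅋E₁ p D E) a∈ = fv-true₂ D E (lin∈-fuel p a∈)
fv-true (⅋E₂ p D E) a∈ = fv-true₂ D E (lin∈-fuel p a∈)
fv-true (!I p D) a∈ = ⊥-elim (lin∉free (lin∈-fuel p a∈) (box-free D))
fv-true (!E {W₁ = W₁} {M = M} p D E) a∈ with ∈-++⁻ W₁ (lin∈-fuel p a∈)
... | inj₁ a∈₁ = ∨-trueʳ (fv-true D a∈₁)
... | inj₂ a∈₂ = ∨-trueˡ (fv-true E (lin∈-▹ᵘ M a∈₂))
fv-true (?I {M = M} p D) a∈ = fv-true D (lin∈-▹ᵘ M (lin∈-fuel p a∈))
fv-true (?E {W₁ = W₁} p D E) a∈ with ∈-++⁻ W₁ (lin∈-fuel p a∈)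
... | inj₁ a∈₁ = ∨-trueʳ (fv-true D a∈₁)
... | inj₂ a∈₂ = ⊥-elim (lin∉free a∈₂ (box-free E))
fv-true (cut p D E) a∈ = fv-true₂ D E (∈-resp-↭ p a∈)
fv-true (𝟏I f) a∈ = ⊥-elim (lin∉free a∈ f)
fv-true (𝟏E {W₁ = W₁} p D E) a∈ with ∈-++⁻ W₁ (∈-resp-↭ p a∈)
... | inj₁ a∈₁ = ∨-trueʳ (fv-true D a∈₁)
... | inj₂ a∈₂ = ∨-trueˡ (fv-true E a∈₂)

-- W is W₀ plus the only occurrence of a.
record Lone (a : Fin n) (x : Pt) (W W₀ : Res m n) : Set where
  constructor lone
  field
    front : W ↭ lin a x ∷ W₀
    fresh : All (a #_) W₀

lone∈ : Lone a x W W₀ → lin a x ∈ W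
lone∈ (lone p _) = ∈-resp-↭ (↭-sym p) (here refl)

lone-▹ : Lone a x W W₀ → Lone (suc a) x (y ▹ W) (y ▹ W₀)
lone-▹ {a = a} {x = x} (lone p f) = lone (▹-↭ {V = lin a x ∷ []} p) (#-▹ f)

lone-▹ᵘ : ∀ M → Lone a x W W₀ → Lone a x (M ▹ᵘ W) (M ▹ᵘ W₀)
lone-▹ᵘ {a = a} {x = x} M (lone p f) = lone (▹ᵘ-↭ {V = lin a x ∷ []} M p) (#-▹ᵘ M f)

lone-fuel : W ↭ fuel ∷ V → Lone a x W W₀ → ∃[ V₀ ] Lone a x V V₀ × W₀ ↭ fuel ∷ V₀
lone-fuel p l@(lone q f) with ↭-front (lin∈-fuel p (lone∈ l))
... | V₀ , r = V₀ , lone r (All.tail (All-resp-↭ q₀ f)) , q₀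
  where q₀ = drop-∷ (trans (↭-sym q) (trans p (trans (prep _ r) (swap _ _ refl))))

-- The premise that holds the only occurrence of `a`; it selects the clause of contra-substitution.
data Located (a : Fin n) (x : Pt) (W₀ W₁ W₂ : Res m n) : Set where
  inˡ : ∀ {V₁} → Lone a x W₁ V₁ → All (a #_) W₂ → W₀ ↭ V₁ ++ W₂ → Located a x W₀ W₁ W₂
  inʳ : ∀ {V₂} → All (a #_) W₁ → Lone a x W₂ V₂ → W₀ ↭ W₁ ++ V₂ → Located a x W₀ W₁ W₂

locate : W ↭ W₁ ++ W₂ → Lone a x W W₀ → Located a x W₀ W₁ W₂
locate {W₁ = W₁} {W₂} {x = x} p l@(lone q f) with ∈-++⁻ W₁ (∈-resp-↭ p (lone∈ l))
... | inj₁ a∈ with ↭-front a∈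
...   | V₁ , r = inˡ (lone r (Allₚ.++⁻ˡ V₁ g)) (Allₚ.++⁻ʳ V₁ g) q₀
  where q₀ = drop-∷ (trans (↭-sym q) (trans p (++⁺ʳ W₂ r)))
        g = All-resp-↭ q₀ f
locate {W₁ = W₁} {W₂} {x = x} p l@(lone q f) | inj₂ a∈ with ↭-front a∈
...   | V₂ , r = inʳ (Allₚ.++⁻ˡ W₁ g) (lone r (Allₚ.++⁻ʳ W₁ g)) q₀
  where q₀ = drop-∷ (trans (↭-sym q) (trans p (trans (++⁺ˡ W₁ r) (↭-shift _ W₁ V₂))))
        g = All-resp-↭ q₀ f

▹-++ : ∀ (W V : Res m n) → x ▹ (W ++ V) ≡ (x ▹ W) ++ wkˡ* V
▹-++ W V = cong (lin zero _ ∷_) (map-++ _ W V)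

wkˡ*-▹ᵘ : ∀ M (V : Res m n) → wkˡ* (M ▹ᵘ V) ≡ M ▹ᵘ wkˡ* V
wkˡ*-▹ᵘ M V = ≡-trans (map-++ _ (map (unr zero) M) (wkᵘ* V))
  (cong₂ _++_ (sym (map-∘ M)) (map-comm (λ { fuel → refl ; (lin _ _) → refl ; (unr _ _) → refl }) V))

▹▹-++ : ∀ (W V : Res m n) → y ▹ x ▹ (W ++ V) ≡ (y ▹ x ▹ W) ++ wkˡ* (wkˡ* V)
▹▹-++ {y = y} W V = ≡-trans (cong (y ▹_) (▹-++ W V)) (▹-++ (_ ▹ W) (wkˡ* V))

▹ᵘ-++ : ∀ M (W V : Res m n) → M ▹ᵘ (W ++ V) ≡ (M ▹ᵘ W) ++ wkᵘ* V
▹ᵘ-++ M W V = ≡-trans (cong (map (unr zero) M ++_) (map-++ _ W V))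
                      (sym (Lₚ.++-assoc (map (unr zero) M) (wkᵘ* W) (wkᵘ* V)))

-- A derivation of `t` relates the point `x` of `a` to the result `y`; as dual formulae share their
-- points, it can be read backwards, from `s` at `y` to a result at `x`. Each rule on the path to
-- `a` is turned around with its other premise kept, and its cost pays for the rule that replaces
-- it.
contra : W ⊩ t ∶ y → Lone a x W W₀ → V ⊩ s ∶ y → U ↭ W₀ ++ V → U ⊩ t ⟪ a \\ s ⟫ ∶ x
contra {V = V} (lax q f) (lone p g) S r with ∈-resp-↭ q (∈-resp-↭ (↭-sym p) (here refl))
... | there a∈J = ⊥-elim (lin∉free a∈J f)
-- The token of `a` is the one read by the axiom, so `x` is `y` and all other tokens of `W` are
-- leftovers.
... | here refl = weaken r (All-resp-↭ (drop-∷ (trans (↭-sym q) p)) f) S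
contra (uax q f) l S r = ⊥-elim (lin∉free (∈-resp-↭ q (lone∈ l)) (unr ∷ f))
contra {V = V} (⊗I {W₁ = W₁} {W₂ = W₂} q D E) l S r with lone-fuel q l
... | _ , l′ , q₀ with locate refl l′
...   | inˡ {V₁} l₁ _ q₁ rewrite fv-true D (lone∈ l₁) =
  contra D l₁ (⅋E₂ refl S E) (insert₁ (fuel ∷ []) V₁ W₂ V r (trans q₀ (prep _ q₁)))
...   | inʳ {V₂} f₁ l₂ q₁ rewrite fv-false D f₁ =
  contra E l₂ (⅋E₁ refl S D) (insert₂ (fuel ∷ []) W₁ V₂ V r (trans q₀ (prep _ q₁)))
contra {V = V} (⅋E₁ {W₁ = W₁} {W₂ = W₂} q D E) l S r with lone-fuel q l
... | _ , l′ , q₀ with locate refl l′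
...   | inˡ {V₁} l₁ _ q₁ rewrite fv-true D (lone∈ l₁) =
  contra D l₁ (⊗I (prep _ (++-comm V W₂)) E S)
    (insert₁ (fuel ∷ []) V₁ W₂ V r (trans q₀ (prep _ q₁)))
...   | inʳ {V₂} f₁ l₂ q₁ rewrite fv-false D f₁ =
  contra E l₂ (⅋E₂ (prep _ (++-comm V W₁)) D S)
    (insert₂ (fuel ∷ []) W₁ V₂ V r (trans q₀ (prep _ q₁)))
contra {V = V} (⅋E₂ {W₁ = W₁} {W₂ = W₂} q D E) l S r with lone-fuel q l
... | _ , l′ , q₀ with locate refl l′
...   | inˡ {V₁} l₁ _ q₁ rewrite fv-true D (lone∈ l₁) =
  contra D l₁ (⊗I refl S E) (insert₁ (fuel ∷ []) V₁ W₂ V r (trans q₀ (prep _ q₁)))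
...   | inʳ {V₂} f₁ l₂ q₁ rewrite fv-false D f₁ =
  contra E l₂ (⅋E₁ (prep _ (++-comm V W₁)) D S)
    (insert₂ (fuel ∷ []) W₁ V₂ V r (trans q₀ (prep _ q₁)))
contra {V = V} (⊗E {W₁ = W₁} {W₂ = W₂} q D E) l S r with lone-fuel q l
... | _ , l′ , q₀ with locate refl l′
...   | inˡ {V₁} l₁ f₂ q₁ rewrite fv-false E (#-▹ (#-▹ f₂)) =
  contra D l₁
    -- The fuel of `⊗E` pays for this `⅋I`; the cut inside is free.
    (⅋I refl (cut (trans (▹-↭ {V = wkˡ* V} (▹-↭ {V = V} refl)) (++-comm (wkˡ* (wkˡ* V)) _))
                  E (renaming-⊩ id suc (renaming-⊩ id suc S))))
    (insert₁ (fuel ∷ []) V₁ W₂ V r (trans q₀ (prep _ q₁)))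
...   | inʳ {V₂} f₁ l₂ q₁ rewrite fv-true E (lin∈-▹ (lin∈-▹ (lone∈ l₂))) =
  ⊗E (append₂ (fuel ∷ []) W₁ V₂ V r (trans q₀ (prep _ q₁))) D
     (contra E (lone-▹ (lone-▹ l₂)) (renaming-⊩ id suc (renaming-⊩ id suc S))
       (↭-reflexive (▹▹-++ V₂ V)))
contra {V = V} (⅋I q D) l S r with lone-fuel q l
... | V₀ , l′ , q₀ =
  -- The fuel of `⅋I` pays for this `⊗E`, and the `⋆` sent into the body consumes nothing.
  ⊗E (trans r (trans (++⁺ʳ V q₀) (prep _ (++-comm V₀ V)))) S
     (contra D (lone-▹ (lone-▹ l′)) (𝟏I []) (↭-sym (++-identityʳ _)))
contra (!I q D) l S r = ⊥-elim (lin∉free (lin∈-fuel q (lone∈ l)) (box-free D))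
contra {V = V} (!E {W₁ = W₁} {W₂ = W₂} {M = M} q D E) l S r with lone-fuel q l
... | _ , l′ , q₀ with locate refl l′
...   | inˡ {V₁} l₁ f₂ q₁ rewrite fv-false E (#-▹ᵘ M f₂) =
  contra D l₁
    (?I refl (cut (trans (▹ᵘ-↭ {V = V} M refl) (++-comm (wkᵘ* V) _)) E (renaming-⊩ suc id S)))
    (insert₁ (fuel ∷ []) V₁ W₂ V r (trans q₀ (prep _ q₁)))
...   | inʳ {V₂} f₁ l₂ q₁ rewrite fv-true E (lin∈-▹ᵘ M (lone∈ l₂)) =
  !E (append₂ (fuel ∷ []) W₁ V₂ V r (trans q₀ (prep _ q₁))) D
     (contra E (lone-▹ᵘ M l₂) (renaming-⊩ suc id S) (↭-reflexive (▹ᵘ-++ M V₂ V)))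
contra {V = V} (?I {M = M} q D) l S r with lone-fuel q l
... | V₀ , l′ , q₀ =
  !E (trans r (trans (++⁺ʳ V q₀) (prep _ (++-comm V₀ V)))) S
     (contra D (lone-▹ᵘ M l′) (𝟏I []) (↭-sym (++-identityʳ _)))
contra {V = V} (?E {W₂ = W₂} q D E) l S r with lone-fuel q l
... | _ , l′ , q₀ with locate refl l′
...   | inʳ _ l₂ _ = ⊥-elim (lin∉free (lone∈ l₂) (box-free E))
...   | inˡ {V₁} l₁ _ q₁ =
  -- The fuel of `?E` pays for the `!I` built from its box; `𝟏E` is free.
  𝟏E (trans r (++-comm _ V)) S
    (contra D l₁ (!I refl E) (trans q₀ (trans (prep _ q₁) (↭-sym (↭-shift _ V₁ W₂)))))
contra {V = V} (cut {W₁ = W₁} q D E) l S r with locate q l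
... | inˡ l₁ _ q₁ rewrite fv-true D (lone∈ l₁) =
  𝟏E (trans r (++-comm _ V)) S (contra D l₁ E q₁)
... | inʳ f₁ l₂ q₁ rewrite fv-false D f₁ =
  𝟏E (trans r (++-comm _ V)) S (contra E l₂ D (trans q₁ (++-comm W₁ _)))
contra (𝟏I f) l S r = ⊥-elim (lin∉free (lone∈ l) f)
contra {V = V} (𝟏E {W₁ = W₁} {W₂ = W₂} q D E) l S r with locate q l
... | inˡ {V₁} l₁ f₂ q₁ rewrite fv-false E f₂ =
  contra D l₁ (cut (++-comm V W₂) E S) (insert₁ [] V₁ W₂ V r q₁)
... | inʳ {V₂} f₁ l₂ q₁ rewrite fv-true E (lone∈ l₂) =
  𝟏E (append₂ [] W₁ V₂ V r q₁) D (contra E l₂ S refl)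

-- The body ends at `∗`, which `⋆` provides from no resources, so the resources are unchanged. The
-- remaining substitution only drops the index of the bound variable, which no longer has a token.
contra⋆ : x ▹ W ⊩ t ∶ ∗ → W ⊩ t ⟪\\⋆⟫ ∶ x
contra⋆ {W = W} D = cast-⊩ (map-renTok-id W)
  (substitution (contra D (lone refl zero#) (𝟏I []) (↭-sym (++-identityʳ _)))
    (subs-var {θ = suc} {θ′ = id} (λ _ → refl) (λ _ → refl) W))
  where
  zero# : All (zero #_) (wkˡ* W)
  zero# = Allₚ.map⁺ (All.universal (λ { fuel → fuel ; (lin _ _) → lin (λ ()) ; (unr _ _) → unr }) W)

-- Each run of the box, reversed by contra-substitution, realises one occurrence of the unrestricted
-- variable.
box-subs : V ⊩ᵇ s ∶ M → ∀ (W : Res m n) →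
           ∃[ U ] U ↭ V ++ W × Subs (insertAt uvar zero (s ⟪\\⋆⟫)) lvar (M ▹ᵘ W) U
box-subs (last {W = V} (f , D)) W =
  V ++ W , refl , _∷_ {V₁ = V} (f , contra⋆ D)
    (subst (Subs _ _ _) (map-renTok-id W)
      (subs-var {ρ = suc} {θ = id} {ρ′ = id} {θ′ = id} (λ _ → refl) (λ _ → refl) W))
box-subs (_∷⟨_⟩_ {W₁ = V₁} {W₂ = V₂} (f , D) p E) W with box-subs E W
... | U , q , ss =
  V₁ ++ U , trans (++⁺ˡ V₁ q) (trans (↭-sym (++-assoc V₁ V₂ W)) (++⁺ʳ W (↭-sym p))) ,
  (f , contra⋆ D) ∷ ss

substᵘ : M ▹ᵘ H ⊩ t ∶ z → V ⊩ᵇ s ∶ M → H ++ V ⊩ t ⟦≔ᵘ s ⟪\\⋆⟫ ⟧ ∶ z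
substᵘ {H = H} {V = V} D E with box-subs E H
... | U , p , ss = exchange (trans (++-comm H V) (↭-sym p)) (substitution D ss)

-- Elimination contexts

fuel∈map : ∀ {ρ : Fin m → Fin m′} {θ : Fin n → Fin n′} (W : Res m n) →
           fuel ∈ map (renTok ρ θ) W → fuel ∈ W
fuel∈map W f∈ with ∈-map⁻ _ f∈
... | fuel , f∈′ , refl = f∈′

fuel-map : ∀ {ρ : Fin m → Fin m′} {θ : Fin n → Fin n′} → map (renTok ρ θ) W ↭ fuel ∷ V →
           ∃[ W₁ ] W ↭ fuel ∷ W₁ × V ↭ map (renTok ρ θ) W₁
fuel-map {W = W} p with ↭-front (fuel∈map W (∈-resp-↭ (↭-sym p) (here refl)))
... | W₁ , q = W₁ , q , drop-∷ (trans (↭-sym p) (map⁺ _ q))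

-- A binder adds variable tokens only, so fuel burnt under it was already among the outer resources.
fuel-▹ : x ▹ W ↭ fuel ∷ V → ∃[ W₁ ] W ↭ fuel ∷ W₁ × V ↭ x ▹ W₁
fuel-▹ {W = W} p with ∈-resp-↭ (↭-sym p) (here refl)
... | there f∈ with ↭-front (fuel∈map W f∈)
... | W₁ , q = W₁ , q , drop-∷ (trans (↭-sym p) (▹-↭ {V = fuel ∷ []} q))

fuel-▹▹ : y ▹ x ▹ W ↭ fuel ∷ V → ∃[ W₁ ] W ↭ fuel ∷ W₁ × V ↭ y ▹ x ▹ W₁
fuel-▹▹ p with fuel-▹ p
... | _ , q , r with fuel-▹ q
... | W₁ , q′ , r′ = W₁ , q′ , trans r (prep _ (map⁺ _ r′))

fuel-▹ᵘ : ∀ M → M ▹ᵘ W ↭ fuel ∷ V → ∃[ W₁ ] W ↭ fuel ∷ W₁ × V ↭ M ▹ᵘ W₁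
fuel-▹ᵘ {W = W} M p with ∈-++⁻ (map (unr zero) M) (∈-resp-↭ (↭-sym p) (here refl))
... | inj₁ f∈ with ∈-map⁻ _ f∈
...   | _ , _ , ()
fuel-▹ᵘ {W = W} M p | inj₂ f∈ with ↭-front (fuel∈map W f∈)
...   | W₁ , q = W₁ , q , drop-∷ (trans (↭-sym p) (▹ᵘ-↭ {V = fuel ∷ []} M q))

-- W provides for the context L and leaves H to the term in its hole.
data Frame {m n} : ECtx m n p q → Res m n → Res (p ▷ m) (q ▷ n) → Set where
  □  : Frame □ W W
  ⊗E : ∀ {L : ECtx m (2 + n) p q} → W ↭ fuel ∷ W₁ ++ W₂ → W₁ ⊩ s ∶ x ∙ y →
       Frame L (y ▹ x ▹ W₂) H → Frame (L [⟨⟩≔ s ]) W H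
  !E : ∀ {L : ECtx (1 + m) n p q} → W ↭ fuel ∷ W₁ ++ W₂ → W₁ ⊩ s ∶ bag M →
       Frame L (M ▹ᵘ W₂) H → Frame (L [!≔ s ]) W H
  𝟏E : ∀ {L : ECtx m n p q} → W ↭ W₁ ++ W₂ → W₁ ⊩ s ∶ ∗ →
       Frame L W₂ H → Frame (L [⋆≔ s ]) W H

unplug : ∀ (L : ECtx m n p q) {t} → W ⊩ t ⟨ L ⟩ ∶ x → ∃[ H ] Frame L W H × (H ⊩ t ∶ x)
unplug □ D = _ , □ , D
unplug (L [⟨⟩≔ s ]) (⊗E p D E) with unplug L E
... | _ , F , T = _ , ⊗E p D F , T
unplug (L [!≔ s ]) (!E p D E) with unplug L E
... | _ , F , T = _ , !E p D F , T
unplug (L [⋆≔ s ]) (𝟏E p D E) with unplug L E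
... | _ , F , T = _ , 𝟏E p D F , T

-- The unit in `H` is the one paid by the constructor in the hole. It is traced out through the
-- binders of `L`, while `R`, the resources of an argument brought in from outside, is renamed into
-- the scope of the hole.
plug : ∀ {L : ECtx m n p q} {t x} → Frame L W H → H ↭ fuel ∷ H′ →
       U ↭ H′ ++ map (renTok (shift p) (shift q)) R → U ⊩ t ∶ x →
       ∃[ V ] W ↭ fuel ∷ V × (V ++ R ⊩ t ⟨ L ⟩ ∶ x)
plug {R = R} □ p r T = _ , p , exchange (trans (++⁺ˡ _ (↭-reflexive (sym (map-renTok-id R)))) (↭-sym r)) T
plug {R = R} (⊗E {W₁ = W₁} {W₂ = W₂} p D F) h r T
  with plug {R = wkˡ* (wkˡ* R)} F h (trans r (++⁺ˡ _ (↭-reflexive (≡-trans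
         (map-cong (λ { fuel → refl ; (lin _ _) → refl ; (unr _ _) → refl }) R)
         (≡-trans (map-∘ R) (cong (map _) (wkˡ*-wkˡ* R))))))) T
... | _ , q , E with fuel-▹▹ q
... | V₂ , q′ , r′ =
  fuel ∷ W₁ ++ V₂ ,
  trans p (prep _ (trans (++⁺ˡ W₁ q′) (↭-shift fuel W₁ V₂))) ,
  ⊗E (prep _ (++-assoc W₁ V₂ R)) D
     (exchange (trans (↭-reflexive (▹▹-++ V₂ R)) (++⁺ʳ _ (↭-sym r′))) E)
plug {R = R} (!E {W₁ = W₁} {W₂ = W₂} {M = M} p D F) h r T
  with plug {R = wkᵘ* R} F h (trans r (++⁺ˡ _ (↭-reflexive (≡-trans
         (map-cong (λ { fuel → refl ; (lin _ _) → refl ; (unr _ _) → refl }) R)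
         (map-∘ R))))) T
... | _ , q , E with fuel-▹ᵘ M q
... | V₂ , q′ , r′ =
  fuel ∷ W₁ ++ V₂ ,
  trans p (prep _ (trans (++⁺ˡ W₁ q′) (↭-shift fuel W₁ V₂))) ,
  !E (prep _ (++-assoc W₁ V₂ R)) D
     (exchange (trans (↭-reflexive (▹ᵘ-++ M V₂ R)) (++⁺ʳ _ (↭-sym r′))) E)
plug {R = R} (𝟏E {W₁ = W₁} p D F) h r T with plug {R = R} F h r T
... | V₂ , q , E =
  W₁ ++ V₂ , trans p (trans (++⁺ˡ W₁ q) (↭-shift fuel W₁ V₂)) , 𝟏E (++-assoc W₁ V₂ R) D E

lift▷-cong : ∀ p {f g : Fin m → Fin n} → (∀ i → f i ≡ g i) → ∀ i → lift▷ p f i ≡ lift▷ p g i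
lift▷-cong zero    eq = eq
lift▷-cong (suc p) eq = lift▷-cong p λ { zero → refl ; (suc i) → cong suc (eq i) }

renTok-cong : ∀ {ρ ρ′ : Fin m → Fin m′} {θ θ′ : Fin n → Fin n′} →
              (∀ u → ρ u ≡ ρ′ u) → (∀ a → θ a ≡ θ′ a) → ∀ W → map (renTok ρ θ) W ≡ map (renTok ρ′ θ′) W
renTok-cong hu hl = map-cong λ
  { fuel      → refl
  ; (lin a x) → cong (λ b → lin b x) (hl a)
  ; (unr u x) → cong (λ v → unr v x) (hu u) }

-- Needed because `lift▷` passes one binder at a time, whereas `renᴸ` lifts by two at a tensor
-- elimination.
lift-2 : ∀ (θ : Fin n → Fin n′) i → lift 2 θ i ≡ lift 1 (lift 1 θ) i
lift-2 θ zero          = refl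
lift-2 θ (suc zero)    = refl
lift-2 θ (suc (suc i)) = refl

renaming-frame : ∀ (ρ : Fin m → Fin m′) (θ : Fin n → Fin n′) {L : ECtx m n p q} → Frame L W H →
                 Frame (renᴸ ρ θ L) (map (renTok ρ θ) W) (map (renTok (lift▷ p ρ) (lift▷ q θ)) H)
renaming-frame ρ θ □ = □
renaming-frame ρ θ {L = _[⟨⟩≔_] {q = q} L _} (⊗E {W₁ = W₁} {W₂ = W₂} {H = H} r D F) =
  ⊗E (map-↭-++ _ (fuel ∷ []) W₁ W₂ r) (renaming-⊩ ρ θ D)
     (subst₂ (Frame _) (ren-▹▹ W₂) (renTok-cong (λ _ → refl) (lift▷-cong q (lift-2 θ)) H)
       (renaming-frame ρ (lift 2 θ) F))
renaming-frame ρ θ (!E {W₁ = W₁} {W₂ = W₂} {M = M} r D F) =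
  !E (map-↭-++ _ (fuel ∷ []) W₁ W₂ r) (renaming-⊩ ρ θ D)
     (subst (λ V → Frame _ V _) (ren-▹ᵘ M W₂) (renaming-frame (lift 1 ρ) θ F))
renaming-frame ρ θ (𝟏E {W₁ = W₁} {W₂ = W₂} r D F) =
  𝟏E (map-↭-++ _ [] W₁ W₂ r) (renaming-⊩ ρ θ D) (renaming-frame ρ θ F)

-- Subject reduction: a step burns fuel

Step : Res m n → Tm m n → Pt → Set
Step W t x = ∃[ V ] W ↭ fuel ∷ V × (V ⊩ t ∶ x)

-- For the rules in which an eliminator meets a constructor: `W₁` derives the term under `L`, and
-- `W₂` the other argument.
plug-step : ∀ {L : ECtx m n p q} {t x} → W ↭ fuel ∷ W₁ ++ W₂ → Frame L W₁ H → H ↭ fuel ∷ H′ →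
            U ↭ H′ ++ map (renTok (shift p) (shift q)) W₂ → U ⊩ t ∶ x → Step W (t ⟨ L ⟩) x
plug-step {W₂ = W₂} r F h u T with plug {R = W₂} F h u T
-- Eliminator and constructor each paid one unit; one is burnt and the other remains as a leftover.
... | V , v , D = fuel ∷ V ++ W₂ , trans r (prep _ (++⁺ʳ W₂ v)) ,
                  weaken {J = fuel ∷ []} refl (fuel ∷ []) D

-- `L` ends up inside `K`, so `plug` is used twice: first for the renamed `L`, importing the
-- resources from the hole of `K`, then for `K`, importing what `L` needs. In between, `fuel-map`
-- carries the burnt unit back out of the renaming.
plug₂-step : ∀ {p q p′ q′} {L : ECtx m n p q} {K : ECtx m n p′ q′} {t x}
             {H H₁ : Res (p ▷ m) (q ▷ n)} {G G₁ : Res (p′ ▷ m) (q′ ▷ n)} {U : Res (p ▷ (p′ ▷ m)) (q ▷ (q′ ▷ n))} →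
             W ↭ W₁ ++ W₂ → Frame L W₁ H → H ↭ fuel ∷ H₁ → Frame K W₂ G → G ↭ fuel ∷ G₁ →
             U ↭ map (renTok (lift▷ p (shift p′)) (lift▷ q (shift q′))) H₁
                 ++ map (renTok (shift p) (shift q)) G₁ →
             U ⊩ t ∶ x → Step W (t ⟨ renᴸ (shift p′) (shift q′) L ⟩ ⟨ K ⟩) x
plug₂-step {W₁ = W₁} {W₂ = W₂} {G₁ = G₁} r F h E g u T
  with plug {R = G₁} (renaming-frame _ _ F) (map⁺ _ h) u T
... | X , v , D with fuel-map v
... | W₁′ , w₁ , v′ with plug {R = W₁′} E g (trans (++-comm X G₁) (++⁺ˡ G₁ v′)) D
... | W₂′ , w₂ , D′ =
  -- A cut is free, but both constructors paid: one unit is burnt and one is left over.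
  fuel ∷ W₂′ ++ W₁′ ,
  trans r (trans (++⁺ w₁ w₂) (prep _ (trans (↭-shift fuel W₁′ W₂′) (prep _ (++-comm W₁′ W₂′))))) ,
  weaken {J = fuel ∷ []} refl (fuel ∷ []) D′

rename-split : ∀ {ρ : Fin m → Fin m′} {θ : Fin n → Fin n′} (W : Res m′ n′) (V₁ V₂ : Res m n) →
               (W ++ map (renTok ρ θ) V₁) ++ map (renTok ρ θ) V₂ ↭ W ++ map (renTok ρ θ) (V₁ ++ V₂)
rename-split W V₁ V₂ = trans (++-assoc W _ _) (++⁺ˡ W (↭-reflexive (sym (map-++ _ V₁ V₂))))

axiom-step : t ↦ t′ → W ⊩ t ∶ x → Step W t′ x
axiom-step (⅋• {p = p} {q} L t r) (⅋E₁ w D E) with unplug L D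
... | _ , F , ⅋I h T =
  plug-step w F h refl (contra⋆ (subst₁ T (renaming-⊩ (shift p) (shift q) E)))
axiom-step (⅋▾ {p = p} {q} L t r) (⅋E₂ {W₂ = W₂} w D E) with unplug L D
... | _ , F , ⅋I {W₁ = H₁} h T =
  plug-step w F h refl
    (contra⋆ (cast-⊩ (sym (▹-++ H₁ _))
      (subst₀ T (renaming-⊩ id suc (renaming-⊩ (shift p) (shift q) E)))))
axiom-step (⊗β {p = p} {q} L t s r) (⊗E {W₂ = W₂} w D E) with unplug L D
... | _ , F , ⊗I {W₁ = H₁} {W₂ = H₂} h S R =
  plug-step w F h
    (trans (++-assoc (map _ W₂) H₁ H₂) (++-comm (map _ W₂) (H₁ ++ H₂)))
    (subst₀ (subst₁ (cast-⊩ (ren-▹▹ W₂) (renaming-⊩ (shift p) (lift 2 (shift q)) E)) S) R)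
axiom-step (!β {p = p} {q} L t s) (!E {W₂ = W₂} {M = M} w D E) with unplug L D
... | _ , F , !I {W₁ = H₁} h B =
  plug-step w F h (++-comm (map _ W₂) H₁)
    (substᵘ (cast-⊩ (ren-▹ᵘ M W₂) (renaming-⊩ (lift 1 (shift p)) (shift q) E)) B)
axiom-step (?β {p = p} {q} L t s) (?E w D B) with unplug L D
... | _ , F , ?I h T =
  plug-step w F h refl (substᵘ T (renaming-⊩ᵇ (shift p) (shift q) B))
axiom-step (⅋♯⊗ {p = p} {q} {p′} {q′} L K t s r) (cut w D E) with unplug L D | unplug K E
... | _ , F , ⅋I {W₁ = H₁} h T | _ , G , ⊗I {W₁ = G₁} {W₂ = G₂} g S R =
  plug₂-step w F h G g (rename-split _ G₁ G₂)
    (subst₀ (subst₁ (cast-⊩ (ren-▹▹ H₁)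
                      (renaming-⊩ (lift▷ p (shift p′)) (lift 2 (lift▷ q (shift q′))) T))
                    (renaming-⊩ (shift p) (shift q) S))
            (renaming-⊩ (shift p) (shift q) R))
axiom-step (⊗♯⅋ {p = p} {q} {p′} {q′} L K t s r) (cut w D E) with unplug L D | unplug K E
... | _ , F , ⊗I {W₁ = H₁} {W₂ = H₂} h S R | _ , G , ⅋I {W₁ = G₁} g T =
  plug₂-step w F h G g
    (trans (rename-split _ H₁ H₂) (++-comm (map _ G₁) _))
    (subst₀ (subst₁ (cast-⊩ (ren-▹▹ G₁) (renaming-⊩ (shift p) (lift 2 (shift q)) T))
                    (renaming-⊩ (lift▷ p (shift p′)) (lift▷ q (shift q′)) S))
            (renaming-⊩ (lift▷ p (shift p′)) (lift▷ q (shift q′)) R))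
axiom-step (!♯? {p = p} {q} {p′} {q′} L K t r) (cut w D E) with unplug L D | unplug K E
... | _ , F , !I h B | _ , G , ?I {W₁ = G₁} {M = M} g T =
  plug₂-step w F h G g (++-comm (map _ G₁) _)
    (substᵘ (cast-⊩ (ren-▹ᵘ M G₁) (renaming-⊩ (lift 1 (shift p)) (shift q) T))
            (renaming-⊩ᵇ (lift▷ p (shift p′)) (lift▷ q (shift q′)) B))
axiom-step (?♯! {p = p} {q} {p′} {q′} L K t r) (cut w D E) with unplug L D | unplug K E
... | _ , F , ?I {W₁ = H₁} {M = M} h T | _ , G , !I g B =
  plug₂-step w F h G g refl
    (substᵘ (cast-⊩ (ren-▹ᵘ M H₁)
              (renaming-⊩ (lift 1 (lift▷ p (shift p′))) (lift▷ q (shift q′)) T))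
            (renaming-⊩ᵇ (shift p) (shift q) B))

-- By induction on the place of the redex. Every subterm has a premise, boxes included because bags
-- are nonempty, so the fuel is always found and moved to the front.
reduction-step : t →⁻ t′ → W ⊩ t ∶ x → Step W t′ x
reduction-stepᵇ : t →⁻ t′ → W ⊩ᵇ t ∶ M → ∃[ V ] W ↭ fuel ∷ V × (V ⊩ᵇ t′ ∶ M)

reduction-step (axiom r _ _) D = axiom-step r D
reduction-step (⟨-,⟩ r) (⊗I {W₂ = W₂} p D E) with reduction-step r D
... | _ , q , D′ = _ , burn₁ (fuel ∷ []) W₂ p q , ⊗I refl D′ E
reduction-step (⟨,-⟩ r) (⊗I {W₁ = W₁} p D E) with reduction-step r E
... | _ , q , E′ = _ , burn₂ (fuel ∷ []) W₁ p q , ⊗I refl D E′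
reduction-step (-[⟨⟩≔] r) (⊗E {W₁ = W₁} p D E) with reduction-step r E
... | _ , q , E′ with fuel-▹▹ q
... | _ , q′ , v = _ , burn₂ (fuel ∷ []) W₁ p q′ , ⊗E refl D (exchange (↭-sym v) E′)
reduction-step ([⟨⟩≔-] r) (⊗E {W₂ = W₂} p D E) with reduction-step r D
... | _ , q , D′ = _ , burn₁ (fuel ∷ []) W₂ p q , ⊗E refl D′ E
reduction-step (⅋λ- r) (⅋I p D) with reduction-step r D
... | _ , q , D′ with fuel-▹▹ q
... | _ , q′ , v = _ , burn₂ (fuel ∷ []) [] p q′ , ⅋I refl (exchange (↭-sym v) D′)
reduction-step (-• r) (⅋E₁ {W₂ = W₂} p D E) with reduction-step r D
... | _ , q , D′ = _ , burn₁ (fuel ∷ []) W₂ p q , ⅋E₁ refl D′ E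
reduction-step (•- r) (⅋E₁ {W₁ = W₁} p D E) with reduction-step r E
... | _ , q , E′ = _ , burn₂ (fuel ∷ []) W₁ p q , ⅋E₁ refl D E′
reduction-step (-▾ r) (⅋E₂ {W₂ = W₂} p D E) with reduction-step r D
... | _ , q , D′ = _ , burn₁ (fuel ∷ []) W₂ p q , ⅋E₂ refl D′ E
reduction-step (▾- r) (⅋E₂ {W₁ = W₁} p D E) with reduction-step r E
... | _ , q , E′ = _ , burn₂ (fuel ∷ []) W₁ p q , ⅋E₂ refl D E′
reduction-step (!λ- r) (!I p D) with reduction-stepᵇ r D
... | _ , q , D′ = _ , burn₂ (fuel ∷ []) [] p q , !I refl D′
reduction-step (-[!≔] r) (!E {W₁ = W₁} {M = M} p D E) with reduction-step r E
... | _ , q , E′ with fuel-▹ᵘ M q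
... | _ , q′ , v = _ , burn₂ (fuel ∷ []) W₁ p q′ , !E refl D (exchange (↭-sym v) E′)
reduction-step ([!≔-] r) (!E {W₂ = W₂} p D E) with reduction-step r D
... | _ , q , D′ = _ , burn₁ (fuel ∷ []) W₂ p q , !E refl D′ E
reduction-step (?λ- r) (?I {M = M} p D) with reduction-step r D
... | _ , q , D′ with fuel-▹ᵘ M q
... | _ , q′ , v = _ , burn₂ (fuel ∷ []) [] p q′ , ?I refl (exchange (↭-sym v) D′)
reduction-step (-▶ r) (?E {W₁ = W₁} p D E) with reduction-stepᵇ r E
... | _ , q , E′ = _ , burn₂ (fuel ∷ []) W₁ p q , ?E refl D E′
reduction-step (▶- r) (?E {W₂ = W₂} p D E) with reduction-step r D
... | _ , q , D′ = _ , burn₁ (fuel ∷ []) W₂ p q , ?E refl D′ E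
reduction-step (-♯ r) (cut {W₂ = W₂} p D E) with reduction-step r D
... | _ , q , D′ = _ , burn₁ [] W₂ p q , cut refl D′ E
reduction-step (♯- r) (cut {W₁ = W₁} p D E) with reduction-step r E
... | _ , q , E′ = _ , burn₂ [] W₁ p q , cut refl D E′
reduction-step (-[⋆≔] r) (𝟏E {W₁ = W₁} p D E) with reduction-step r E
... | _ , q , E′ = _ , burn₂ [] W₁ p q , 𝟏E refl D E′
reduction-step ([⋆≔-] r) (𝟏E {W₂ = W₂} p D E) with reduction-step r D
... | _ , q , D′ = _ , burn₁ [] W₂ p q , 𝟏E refl D′ E

reduction-stepᵇ r (last (f , D)) with reduction-step r D
... | _ , q , D′ with fuel-▹ q
... | _ , q′ , v = _ , q′ , last (All.tail (All-resp-↭ q′ f) , exchange (↭-sym v) D′)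
-- All runs share the body and must step together. Only the unit from the first run is removed; the
-- one from the others is given back as a leftover.
reduction-stepᵇ r (_∷⟨_⟩_ {W₂ = W₂} (f , D) p E) with reduction-step r D | reduction-stepᵇ r E
... | _ , q , D′ | _ , q₂ , E′ with fuel-▹ q
... | _ , q′ , v =
  _ , burn₁ [] W₂ p q′ ,
  (All.tail (All-resp-↭ q′ f) , exchange (↭-sym v) D′)
    ∷⟨ refl ⟩ weakenᵇ {J = fuel ∷ []} q₂ (fuel ∷ []) E′

-- Each step removes a token for good, so the bound `k` on the number of tokens drops. At `k` zero
-- there is no token left to burn.
⊩⇒no-infinite-reduction : ∀ k (f : ℕ → Tm m n) → (∀ i → f i →⁻ f (suc i)) →
                          ∀ {W} i → W ⊩ f i ∶ x → length W ≤ k → Empty.⊥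
⊩⇒no-infinite-reduction k f steps i D W≤k with reduction-step (steps i) D
... | V , q , D′ with ≤-trans (≤-reflexive (sym (↭-length q))) W≤k
⊩⇒no-infinite-reduction (suc k) f steps i D W≤k | V , q , D′ | s≤s V≤k =
  ⊩⇒no-infinite-reduction k f steps (suc i) D′ V≤k

-- Totality

Fact : Set₁
Fact = Pt → Set

Cand : Set₂
Cand = Fact → Set₁

_≬_ : Fact → Fact → Set
X ≬ Y = ∃[ x ] X x × Y x

≬-sym : ∀ {X Y} → X ≬ Y → Y ≬ X
≬-sym (x , p , q) = x , q , p

_⟂ : Cand → Cand
(S ⟂) Y = ∀ X → S X → X ≬ Y

-- Each family is the orthogonal of the other, stated by implications so that families need not be
-- compared by equality.
record Dual (P N : Cand) : Set₁ where
  field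
    meet    : ∀ {X Y} → P X → N Y → X ≬ Y
    total   : ∀ {X} → (∀ Y → N Y → X ≬ Y) → P X
    cototal : ∀ {Y} → (∀ X → P X → X ≬ Y) → N Y

full : Fact
full _ = ⊤

-- Keeping both families makes negation a mere exchange. `full-neg` forces every member of `pos` to
-- be inhabited, and `full-pos` later supplies values for free variables.
record Candidate : Set₂ where
  field
    pos neg  : Cand
    dual     : Dual pos neg
    full-pos : pos full
    full-neg : neg full

  open Dual dual public

open Candidate

flip : Candidate → Candidate
flip C = record
  { pos = neg C ; neg = pos C ; full-pos = full-neg C ; full-neg = full-pos C
  ; dual = record
      { meet    = λ p n → ≬-sym (meet C n p)
      ; total   = λ h → cototal C λ X p → ≬-sym (h X p)
      ; cototal = λ h → total C λ X p → ≬-sym (h X p) } }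

⟂⟂-intro : ∀ {S : Cand} {X} → S X → (S ⟂ ⟂) X
⟂⟂-intro s Y t = ≬-sym (t _ s)

-- A set is in `neg` as soon as it meets every generator, so eliminations need only consider
-- generators. The two hypotheses give the two `full` fields.
generated : (S : Cand) → (∀ X → S X → ∃ X) → S full → Candidate
generated S inhabited f = record
  { pos = S ⟂ ⟂ ; neg = S ⟂
  ; full-pos = ⟂⟂-intro f
  ; full-neg = λ X s → proj₁ (inhabited X s) , proj₂ (inhabited X s) , tt
  ; dual = record
      { meet    = λ p n → ≬-sym (p _ n)
      ; total   = λ h Y n → ≬-sym (h Y n)
      ; cototal = λ h X s → h X (⟂⟂-intro s) } }

inhabited : ∀ C {X} → pos C X → ∃ X
inhabited C p with meet C p (full-neg C)
... | x , q , _ = x , q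

mono : ∀ C {X Y} → (∀ {x} → X x → Y x) → pos C X → pos C Y
mono C X⊆Y p = total C λ Z n → let x , a , b = meet C p n in x , X⊆Y a , b

-- Interpretation of formulae

data Unit (Z : Fact) : Set₁ where
  unit : Z ∗ → Unit Z

_⊠_ : Cand → Cand → Cand
(S ⊠ T) Z = Σ[ X ∈ Fact ] Σ[ Y ∈ Fact ] S X × T Y × (∀ {x y} → X x → Y y → Z (x ∙ y))

-- All nonempty bags over a member of `S`: the explicit head `x` excludes the empty bag.
bang : Cand → Cand
bang S Z = Σ[ X ∈ Fact ] S X × (∀ {x M} → X x → All X M → Z (bag (x ∷ M)))

𝟏ᶜ : Candidate
𝟏ᶜ = generated Unit (λ { _ (unit z) → ∗ , z }) (unit tt)

_⊗ᶜ_ : Candidate → Candidate → Candidate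
C ⊗ᶜ D = generated (pos C ⊠ pos D)
  (λ _ (_ , _ , p , q , ⊆Z) → _ , ⊆Z (proj₂ (inhabited C p)) (proj₂ (inhabited D q)))
  (full , full , full-pos C , full-pos D , λ _ _ → tt)

!ᶜ : Candidate → Candidate
!ᶜ C = generated (bang (pos C))
  (λ _ (_ , p , ⊆Z) → _ , ⊆Z (proj₂ (inhabited C p)) [])
  (full , full-pos C , λ _ _ → tt)

⟦_⟧ : Formula → Candidate
⟦ atom _ ⟧  = 𝟏ᶜ
⟦ atom⁻ _ ⟧ = flip 𝟏ᶜ
⟦ A ⊗ B ⟧   = ⟦ A ⟧ ⊗ᶜ ⟦ B ⟧
⟦ A ⅋ B ⟧   = flip (flip ⟦ A ⟧ ⊗ᶜ flip ⟦ B ⟧)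
⟦ 𝟏 ⟧       = 𝟏ᶜ
⟦ ⊥ ⟧       = flip 𝟏ᶜ
⟦ ! A ⟧     = !ᶜ ⟦ A ⟧
⟦ ⁇ A ⟧     = flip (!ᶜ (flip ⟦ A ⟧))

-- An equality, not just an equivalence: `flip` is involutive by η for records, so rewriting the
-- components suffices.
⟦^⊥⟧ : ∀ A → ⟦ A ^⊥ ⟧ ≡ flip ⟦ A ⟧
⟦^⊥⟧ (atom _)  = refl
⟦^⊥⟧ (atom⁻ _) = refl
⟦^⊥⟧ (A ⊗ B)   rewrite ⟦^⊥⟧ A | ⟦^⊥⟧ B = refl
⟦^⊥⟧ (A ⅋ B)   rewrite ⟦^⊥⟧ A | ⟦^⊥⟧ B = refl
⟦^⊥⟧ 𝟏         = refl
⟦^⊥⟧ ⊥         = refl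
⟦^⊥⟧ (! A)     rewrite ⟦^⊥⟧ A = refl
⟦^⊥⟧ (⁇ A)     rewrite ⟦^⊥⟧ A = refl

pos-^⊥ : ∀ A {X} → pos ⟦ A ^⊥ ⟧ X → neg ⟦ A ⟧ X
pos-^⊥ A {X} = subst (λ C → pos C X) (⟦^⊥⟧ A)

^⊥-pos : ∀ A {X} → neg ⟦ A ⟧ X → pos ⟦ A ^⊥ ⟧ X
^⊥-pos A {X} = subst (λ C → pos C X) (sym (⟦^⊥⟧ A))

neg-^⊥ : ∀ A {X} → neg ⟦ A ^⊥ ⟧ X → pos ⟦ A ⟧ X
neg-^⊥ A {X} = subst (λ C → neg C X) (⟦^⊥⟧ A)

⊥-pos : ∀ {X} → X ∗ → pos ⟦ ⊥ ⟧ X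
⊥-pos x∗ _ (unit y∗) = ∗ , y∗ , x∗

∗∈⊥ : ∀ {X} → pos ⟦ ⊥ ⟧ X → X ∗
-- The singleton of `∗` is the least set in `Unit`, so meeting it means containing `∗`.
∗∈⊥ p with p (_≡ ∗) (unit refl)
... | _ , refl , x∗ = x∗

-- Environments, denotations and the fundamental lemma

infixr 5 _◃_

_◃_ : ∀ {k} {A : Set₁} → A → (Fin k → A) → Fin (suc k) → A
(x ◃ X) zero    = x
(x ◃ X) (suc i) = X i

data Admits {m n} (X : Fin m → Fact) : Tok m n → Set where
  fuel : Admits {n = n} X fuel
  unr  : ∀ {u x} → X u x → Admits {n = n} X (unr u x)

-- Each variable declared in `Γ` is used exactly once, at a point of its set, and the other linear
-- variables never; unrestricted variables are used any number of times within theirs, and fuel is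
-- unlimited.
Fits : (Fin m → Fact) → (Fin n → Fact) → LCtx n → Res m n → Set
Fits X Y []            W = All (Admits X) W
Fits X Y (nothing ∷ Γ) W = ∃[ V ] W ↭ wkˡ* V × Fits X (Y ∘ suc) Γ V
Fits X Y (just A ∷ Γ)  W = ∃[ x ] ∃[ V ] W ↭ x ▹ V × Y zero x × Fits X (Y ∘ suc) Γ V

data Good : ∀ {n} → (Fin n → Fact) → LCtx n → Set₁ where
  []      : ∀ {Y} → Good Y []
  nothing : ∀ {Y : Fin (suc n) → Fact} {Γ} → Good (Y ∘ suc) Γ → Good Y (nothing ∷ Γ)
  just    : ∀ {Y : Fin (suc n) → Fact} {Γ A} → pos ⟦ A ⟧ (Y zero) → Good (Y ∘ suc) Γ → Good Y (just A ∷ Γ)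

good-∅ : ∀ {n} {Y : Fin n → Fact} → Good Y ∅
good-∅ {zero}  = []
good-∅ {suc n} = nothing good-∅

good-lookup : ∀ {n A} {Y : Fin n → Fact} a → Good Y [ a ↦ A ] → pos ⟦ A ⟧ (Y a)
good-lookup zero    (just p _)  = p
good-lookup (suc a) (nothing g) = good-lookup a g

good-full : (Γ : LCtx n) → Good (λ _ → full) Γ
good-full []            = []
good-full (nothing ∷ Γ) = nothing (good-full Γ)
good-full (just A ∷ Γ)  = just (full-pos ⟦ A ⟧) (good-full Γ)

good-split : ∀ {Y : Fin n → Fact} {Γ Γ₁ Γ₂} → Γ₁ , Γ₂ ≣ Γ → Good Y Γ → Good Y Γ₁ × Good Y Γ₂
good-split []          []          = [] , []
good-split (neither p) (nothing g) with good-split p g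
... | g₁ , g₂ = nothing g₁ , nothing g₂
good-split (left p)    (just a g)  with good-split p g
... | g₁ , g₂ = just a g₁ , nothing g₂
good-split (right p)   (just a g)  with good-split p g
... | g₁ , g₂ = nothing g₁ , just a g₂

≣-∅ʳ : ∀ {n} (Γ : LCtx n) → Γ , ∅ ≣ Γ
≣-∅ʳ []            = []
≣-∅ʳ (nothing ∷ Γ) = neither (≣-∅ʳ Γ)
≣-∅ʳ (just _ ∷ Γ)  = left (≣-∅ʳ Γ)

module _ {X : Fin m → Fact} where

  fits-[] : ∀ {n} {Y : Fin n → Fact} → Fits X Y ∅ []
  fits-[] {zero}  = []
  fits-[] {suc n} = [] , refl , fits-[]

  fits-lin : ∀ {n A} {Y : Fin n → Fact} a → Y a x → Fits X Y [ a ↦ A ] (lin a x ∷ [])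
  fits-lin zero    y = _ , [] , refl , y , fits-[]
  fits-lin (suc a) y = _ , refl , fits-lin a y

  fits-unr : ∀ {n u} {Y : Fin n → Fact} → X u x → Fits X Y ∅ (unr u x ∷ [])
  fits-unr {n = zero}  p = unr p ∷ []
  fits-unr {n = suc n} p = unr _ _ ∷ [] , refl , fits-unr p

  fits-fuel : ∀ {n} {Y : Fin n → Fact} Γ {W} → Fits X Y Γ W → Fits X Y Γ (fuel ∷ W)
  fits-fuel []            os              = fuel ∷ os
  fits-fuel (nothing ∷ Γ) (V , p , f)     = fuel ∷ V , prep _ p , fits-fuel Γ f
  fits-fuel (just A ∷ Γ)  (x , V , p , y , f) =
    x , fuel ∷ V , trans (prep _ p) (swap _ _ refl) , y , fits-fuel Γ f

  fits-++ : ∀ {n} {Y : Fin n → Fact} {Γ Γ₁ Γ₂ W₁ W₂} → Γ₁ , Γ₂ ≣ Γ →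
            Fits X Y Γ₁ W₁ → Fits X Y Γ₂ W₂ → Fits X Y Γ (W₁ ++ W₂)
  fits-++ [] os os′ = Allₚ.++⁺ os os′
  fits-++ (neither r) (V₁ , p , f) (V₂ , q , g) =
    _ , trans (++⁺ p q) (↭-reflexive (sym (map-++ _ V₁ V₂))) , fits-++ r f g
  fits-++ (left r) (_ , V₁ , p , y , f) (V₂ , q , g) =
    _ , _ , trans (++⁺ p q) (prep _ (↭-reflexive (sym (map-++ _ V₁ V₂)))) , y , fits-++ r f g
  fits-++ (right r) (V₁ , p , f) (_ , V₂ , q , y , g) =
    _ , _ , trans (++⁺ p q) (trans (↭-shift _ (wkˡ* V₁) (wkˡ* V₂))
              (prep _ (↭-reflexive (sym (map-++ _ V₁ V₂))))) , y , fits-++ r f g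

  fits-free : ∀ {n} {Y : Fin n → Fact} {W} → Fits X Y ∅ W → All Free W
  fits-free {zero}  os          = All.map (λ { fuel → fuel ; (unr _) → unr }) os
  fits-free {suc n} (_ , p , f) = All-resp-↭ (↭-sym p) (free-ren (fits-free f))

  admits-▹ᵘ : ∀ {X₀} {W : Res (suc m) 0} → All (Admits (X₀ ◃ X)) W →
              ∃[ M ] ∃[ V ] All X₀ M × W ↭ M ▹ᵘ V × All (Admits X) V
  admits-▹ᵘ [] = [] , [] , [] , refl , []
  admits-▹ᵘ (o ∷ os) with admits-▹ᵘ os
  admits-▹ᵘ (fuel ∷ os)                  | M , V , ms , p , vs =
    M , fuel ∷ V , ms , trans (prep _ p) (↭-sym (↭-shift fuel (map (unr zero) M) (wkᵘ* V))) , fuel ∷ vs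
  admits-▹ᵘ (unr {u = zero} {x} o ∷ os)  | M , V , ms , p , vs =
    x ∷ M , V , o ∷ ms , prep _ p , vs
  admits-▹ᵘ (unr {u = suc u} {x} o ∷ os) | M , V , ms , p , vs =
    M , unr u x ∷ V , ms ,
    trans (prep _ p) (↭-sym (↭-shift (unr (suc u) x) (map (unr zero) M) (wkᵘ* V))) , unr o ∷ vs

  -- Gathers the occurrences of the newest unrestricted variable, scattered through `W`, into one
  -- bag `M`.
  fits-▹ᵘ : ∀ {n} {X₀} {Y : Fin n → Fact} Γ {W} → Fits (X₀ ◃ X) Y Γ W →
            ∃[ M ] ∃[ V ] All X₀ M × W ↭ M ▹ᵘ V × Fits X Y Γ V
  fits-▹ᵘ [] os = admits-▹ᵘ os
  fits-▹ᵘ (nothing ∷ Γ) (_ , p , f) with fits-▹ᵘ Γ f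
  ... | M , V , ms , q , g =
    M , wkˡ* V , ms , trans p (trans (map⁺ _ q) (↭-reflexive (wkˡ*-▹ᵘ M V))) , V , refl , g
  fits-▹ᵘ (just _ ∷ Γ) (x , _ , p , y , f) with fits-▹ᵘ Γ f
  ... | M , V , ms , q , g =
    M , x ▹ V , ms ,
    trans p (trans (prep _ (trans (map⁺ _ q) (↭-reflexive (wkˡ*-▹ᵘ M V))))
      (↭-sym (↭-shift (lin zero x) (map (unr zero) M) _))) ,
    x , V , refl , y , g

-- The results of all experiments on `t` whose variables take points in `X` and `Y`.
Den : (Fin m → Fact) → (Fin n → Fact) → LCtx n → Tm m n → Fact
Den X Y Γ t z = ∃[ W ] Fits X Y Γ W × (W ⊩ t ∶ z)

-- The inputs from which the body reaches `∗` using free tokens only; they are the points offered by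
-- a promoted term.
Box : (Fin m → Fact) → (Fin n → Fact) → Tm m (suc n) → Fact
Box X Y t x = ∃[ W ] Fits X Y ∅ W × (x ▹ W ⊩ t ∶ ∗)

boxes : ∀ {X : Fin m → Fact} {Y : Fin n → Fact} → Box X Y t x → All (Box X Y t) M →
        ∃[ W ] Fits X Y ∅ W × (W ⊩ᵇ t ∶ (x ∷ M))
boxes (W , f , D) [] = W , f , last (fits-free f , D)
boxes (W , f , D) (b ∷ bs) with boxes b bs
... | V , g , E = W ++ V , fits-++ (≣-∅ʳ ∅) f g , (fits-free f , D) ∷⟨ refl ⟩ E

-- By induction on typing. For an elimination, an arbitrary `Z` orthogonal to the result type yields
-- a set of points at which the eliminated term can be consumed so as to reach `Z`; that set meets
-- the term's denotation, and the common point gives the derivation.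
fundamental : ∀ {Δ : UCtx m} {Γ : LCtx n} {t A} {X : Fin m → Fact} {Y : Fin n → Fact} →
              Δ ﹔ Γ ⊢ t ∶ A → (∀ u → pos ⟦ lookup Δ u ⟧ (X u)) → Good Y Γ →
              pos ⟦ A ⟧ (Den X Y Γ t)

-- Against `Z` in the type of `a`, the body with `a` ranging over `Z` reaches `∗`; the point of `Z`
-- it then uses lies in the box.
box-neg : ∀ {Δ : UCtx m} {t : Tm m (suc n)} {A} {X : Fin m → Fact} {Y : Fin n → Fact} →
          Δ ﹔ just A ∷ ∅ ⊢ t ∶ ⊥ → (∀ u → pos ⟦ lookup Δ u ⟧ (X u)) → neg ⟦ A ⟧ (Box X Y t)
box-neg {A = A} {Y = Y} d σ = cototal ⟦ A ⟧ λ Z z → case Z (∗∈⊥ (fundamental {Y = Z ◃ Y} d σ (just z good-∅)))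
  where
  case : ∀ Z → Den _ (Z ◃ Y) (just A ∷ ∅) _ ∗ → Z ≬ Box _ Y _
  case Z (W , (x , _ , p , z , f) , D) = x , z , _ , f , exchange (↭-sym p) D

extend : ∀ {Δ : UCtx m} {A} {X : Fin m → Fact} {Z} → pos ⟦ A ⟧ Z → (∀ u → pos ⟦ lookup Δ u ⟧ (X u)) →
         ∀ u → pos ⟦ lookup (A ∷ Δ) u ⟧ ((Z ◃ X) u)
extend z σ zero    = z
extend z σ (suc u) = σ u

fundamental (lax {a = a} {A}) σ g =
  mono ⟦ A ⟧ (λ y → _ , fits-lin a y , lax refl []) (good-lookup a g)
fundamental {Δ = Δ} (uax {u = u}) σ g =
  mono ⟦ lookup Δ u ⟧ (λ x → _ , fits-unr x , uax refl []) (σ u)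
fundamental (⊗I {A = A} {B} p d e) σ g with good-split p g
... | g₁ , g₂ = ⟂⟂-intro {S = pos ⟦ A ⟧ ⊠ pos ⟦ B ⟧}
  (_ , _ , fundamental d σ g₁ , fundamental e σ g₂ ,
   λ { (W , f , D) (V , h , E) → fuel ∷ W ++ V , fits-fuel _ (fits-++ p f h) , ⊗I refl D E })
fundamental {X = X} {Y} (⊗E {Γ} {Γ₁} {Γ₂} {t} {s} {A} {B} {C} p d e) σ g with good-split p g
... | g₁ , g₂ = total ⟦ C ⟧ λ Z z → finish Z
  -- `Consumer Z` need only meet the generators `U`, which contain all pairs from some `P` and `Q`;
  -- running `t` on `P` and `Q` supplies such a pair.
  (meet ⟦ A ⊗ B ⟧ {Y = Consumer Z} (fundamental d σ g₁) λ U (P , Q , a , b , ⊆U) →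
    consume Z ⊆U (meet ⟦ C ⟧ (fundamental {Y = Q ◃ P ◃ Y} e σ (just b (just a g₂))) z))
  where
  Consumer : Fact → Fact
  Consumer Z v = ∃[ x ] ∃[ y ] ∃[ c ] ∃[ W ] v ≡ x ∙ y × Z c × Fits X Y Γ₂ W × (y ▹ x ▹ W ⊩ t ∶ c)

  consume : ∀ Z {P Q U : Fact} → (∀ {x y} → P x → Q y → U (x ∙ y)) →
            Den X (Q ◃ P ◃ Y) (just B ∷ just A ∷ Γ₂) t ≬ Z → U ≬ Consumer Z
  consume Z ⊆U (c , (W , (y , _ , p₁ , y∈ , x , _ , p₂ , x∈ , f) , D) , z) =
    x ∙ y , ⊆U x∈ y∈ , x , y , c , _ , refl , z , f ,
    exchange (↭-sym (trans p₁ (prep _ (map⁺ _ p₂)))) D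

  finish : ∀ Z → Den X Y Γ₁ s ≬ Consumer Z → Den X Y Γ (t [⟨⟩≔ s ]) ≬ Z
  finish Z (_ , (W , f , D) , x , y , c , V , refl , z , h , E) =
    c , (fuel ∷ W ++ V , fits-fuel _ (fits-++ p f h) , ⊗E refl D E) , z
-- The goal unfolds to meeting each generator `U`, whose factors `P` and `Q` serve as the sets of
-- the two bound variables.
fundamental {X = X} {Y} (⅋I {t = t} {A} {B} d) σ g U (P , Q , a , b , ⊆U)
  with ∗∈⊥ (fundamental {Y = Q ◃ P ◃ Y} d σ (just (neg-^⊥ B b) (just (neg-^⊥ A a) g)))
... | W , (y , _ , p₁ , y∈ , x , _ , p₂ , x∈ , f) , D =
  x ∙ y , ⊆U x∈ y∈ , _ , fits-fuel _ f , ⅋I refl (exchange (↭-sym (trans p₁ (prep _ (map⁺ _ p₂)))) D)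
fundamental {X = X} {Y} (⅋E₁ {Γ} {Γ₁} {Γ₂} {t} {s} {A} {B} p d e) σ g with good-split p g
... | g₁ , g₂ = total ⟦ B ⟧ λ Z z → finish Z
  -- The test is the product of the denotation of `s` with `Z`, hence a generator.
  (fundamental d σ g₁ (λ v → ∃[ x ] ∃[ y ] v ≡ x ∙ y × Den X Y Γ₂ s x × Z y)
    (Den X Y Γ₂ s , Z , pos-^⊥ A (fundamental e σ g₂) , z , λ x∈ y∈ → _ , _ , refl , x∈ , y∈))
  where
  finish : ∀ Z → (λ v → ∃[ x ] ∃[ y ] v ≡ x ∙ y × Den X Y Γ₂ s x × Z y) ≬ Den X Y Γ₁ t → Den X Y Γ (t • s) ≬ Z
  finish Z (_ , (x , y , refl , (V , h , E) , z) , W , f , D) =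
    y , (fuel ∷ W ++ V , fits-fuel _ (fits-++ p f h) , ⅋E₁ refl D E) , z
fundamental {X = X} {Y} (⅋E₂ {Γ} {Γ₁} {Γ₂} {t} {s} {A} {B} p d e) σ g with good-split p g
... | g₁ , g₂ = total ⟦ A ⟧ λ Z z → finish Z
  (fundamental d σ g₁ (λ v → ∃[ x ] ∃[ y ] v ≡ x ∙ y × Z x × Den X Y Γ₂ s y)
    (Z , Den X Y Γ₂ s , z , pos-^⊥ B (fundamental e σ g₂) , λ x∈ y∈ → _ , _ , refl , x∈ , y∈))
  where
  finish : ∀ Z → (λ v → ∃[ x ] ∃[ y ] v ≡ x ∙ y × Z x × Den X Y Γ₂ s y) ≬ Den X Y Γ₁ t → Den X Y Γ (t ▾ s) ≬ Z
  finish Z (_ , (x , y , refl , z , (V , h , E)) , W , f , D) =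
    x , (fuel ∷ W ++ V , fits-fuel _ (fits-++ p f h) , ⅋E₂ refl D E) , z
fundamental {X = X} {Y} (!I {t} {A} d) σ g = ⟂⟂-intro {S = bang (pos ⟦ A ^⊥ ⟧)}
  (Box X Y t , ^⊥-pos A (box-neg {Y = Y} d σ) , promote)
  where
  promote : Box X Y t x → All (Box X Y t) M → Den X Y ∅ (!λ t) (bag (x ∷ M))
  promote b bs with boxes b bs
  ... | W , f , D = fuel ∷ W , fits-fuel _ f , !I refl D
fundamental {X = X} {Y} (!E {Γ} {Γ₁} {Γ₂} {t} {s} {A} {B} p d e) σ g with good-split p g
... | g₁ , g₂ = total ⟦ B ⟧ λ Z z → finish Z
  (meet ⟦ ! A ⟧ {Y = Consumer Z} (fundamental d σ g₁) λ U (P , a , ⊆U) →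
    consume Z (inhabited ⟦ A ⟧ a) ⊆U
      (meet ⟦ B ⟧ (fundamental {X = P ◃ X} e (extend a σ) g₂) z))
  where
  Consumer : Fact → Fact
  Consumer Z v = ∃[ M ] ∃[ c ] ∃[ W ] v ≡ bag M × Z c × Fits X Y Γ₂ W × (M ▹ᵘ W ⊩ t ∶ c)

  consume : ∀ Z {P U : Fact} → ∃ P → (∀ {x M} → P x → All P M → U (bag (x ∷ M))) →
            Den (P ◃ X) Y Γ₂ t ≬ Z → U ≬ Consumer Z
  consume Z (x , x∈) ⊆U (c , (W , f , D) , z) with fits-▹ᵘ _ f
  ... | M , V , ms , q , h =
    bag (x ∷ M) , ⊆U x∈ ms , x ∷ M , c , V , refl , z , h ,
    weaken {J = unr zero x ∷ []} (prep _ (↭-sym q)) (unr ∷ []) D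

  finish : ∀ Z → Den X Y Γ₁ s ≬ Consumer Z → Den X Y Γ (t [!≔ s ]) ≬ Z
  finish Z (_ , (W , f , D) , M , c , V , refl , z , h , E) =
    c , (fuel ∷ W ++ V , fits-fuel _ (fits-++ p f h) , !E refl D E) , z
fundamental {X = X} {Y} (?I {A = A} d) σ g U (P , a , ⊆U)
  with ∗∈⊥ (fundamental {X = P ◃ X} d (extend (^⊥-pos A a) σ) g)
     | inhabited (flip ⟦ A ⟧) a
... | W , f , D | x , x∈ with fits-▹ᵘ _ f
... | M , V , ms , q , h =
  -- Padded by a spare point for the same reason.
  bag (x ∷ M) , ⊆U x∈ ms , fuel ∷ V , fits-fuel _ h ,
  ?I refl (weaken {J = unr zero x ∷ []} (prep _ (↭-sym q)) (unr ∷ []) D)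
fundamental {X = X} {Y} (?E {Γ} {t} {s} {A} d e) σ g = ⊥-pos (finish
  (fundamental d σ g (λ v → ∃[ x ] ∃[ M ] v ≡ bag (x ∷ M) × Box X Y t x × All (Box X Y t) M)
    (_ , box-neg {Y = Y} e σ , λ b bs → _ , _ , refl , b , bs)))
  where
  finish : (λ v → ∃[ x ] ∃[ M ] v ≡ bag (x ∷ M) × Box X Y t x × All (Box X Y t) M) ≬ Den X Y Γ s →
           Den X Y Γ (t ▶ s) ∗
  finish (_ , (x , M , refl , b , bs) , W , f , D) with boxes b bs
  ... | V , h , E = fuel ∷ W ++ V , fits-fuel _ (fits-++ (≣-∅ʳ Γ) f h) , ?E refl D E
fundamental (cut {B = B} p d e) σ g with good-split p g
... | g₁ , g₂ with meet ⟦ B ⟧ (fundamental d σ g₁) (pos-^⊥ B (fundamental e σ g₂))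
... | x , (W , f , D) , (V , h , E) = ⊥-pos (W ++ V , fits-++ p f h , cut refl D E)
fundamental 𝟏I σ g = ⟂⟂-intro {S = Unit} (unit ([] , fits-[] , 𝟏I []))
fundamental {X = X} {Y} (𝟏E {Γ} {Γ₁} {Γ₂} {t} {s} {A} p d e) σ g with good-split p g
... | g₁ , g₂ = total ⟦ A ⟧ λ Z z → finish Z
  (meet ⟦ 𝟏 ⟧ {Y = λ v → v ≡ ∗ × (Den X Y Γ₂ t ≬ Z)} (fundamental d σ g₁)
    λ { _ (unit u) → ∗ , u , refl , meet ⟦ A ⟧ (fundamental e σ g₂) z })
  where
  finish : ∀ Z → Den X Y Γ₁ s ≬ (λ v → v ≡ ∗ × (Den X Y Γ₂ t ≬ Z)) → Den X Y Γ (t [⋆≔ s ]) ≬ Z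
  finish Z (_ , (W , f , D) , refl , c , (V , h , E) , z) = c , (W ++ V , fits-++ p f h , 𝟏E refl D E) , z

-- Every free variable ranges over `full`; the denotation is then a member of its type's family,
-- hence inhabited, and any element of it carries a derivation.
typable⇒⊩ : ∀ {Δ : UCtx m} {Γ : LCtx n} {t A} → Δ ﹔ Γ ⊢ t ∶ A → ∃[ W ] ∃[ x ] (W ⊩ t ∶ x)
typable⇒⊩ {Δ = Δ} {Γ} {A = A} d
  with inhabited ⟦ A ⟧ (fundamental d (λ u → full-pos ⟦ lookup Δ u ⟧) (good-full Γ))
... | x , W , _ , D = W , x , D

mainTheorem5 : ∀ {m n} {Δ : UCtx m} {Γ : LCtx n} {t : Tm m n} {A : Formula} →
    Δ ﹔ Γ ⊢ t ∶ A →
    ¬ (Σ[ f ∈ (ℕ → Tm m n) ] (f 0 ≡ t × ((i : ℕ) → f i →⁻ f (suc i))))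
mainTheorem5 d (f , refl , steps) with typable⇒⊩ d
... | W , _ , D = ⊩⇒no-infinite-reduction (length W) f steps 0 D ≤-refl
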